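{- For all integers $k\ge 3$ and $1\le b\le k-1$ there exists $s_0>0$ such that the following holds for every integer $s\ge s_0$. Let $H$ be a $k$-graph on $n$ vertices, where $n\ge (2(2k-b)^2+1)(k-1)s+s$. If $$e(H)\ge \binom{n}{k}-\binom{n-s+1}{k}+\binom{n-1}{k-1}+\binom{n-1}{k-2}(2k-b)s,$$ then $H$ contains a $Y_{k,b}$-tiling of size $s$.
   Context: A $k$-graph ($k$-uniform hypergraph) $H=(V,E)$ consists of a finite vertex set $V$ and a family $E$ of $k$-element subsets of $V$ (edges); $e(H)=|E|$. For $k>b\ge 0$, $Y_{k,b}$ denotes the $k$-graph on $2k-b$ vertices consisting of two edges that intersect in exactly $b$ vertices. Given $k$-graphs $F$ and $H$, an $F$-tiling in $H$ is a subgraph of $H$ consisting of vertex-disjoint copies of $F$ (copies are not necessarily induced); its size is the number of these copies. -}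

module Defs where

open import Data.Fin.Base using (Fin; toℕ)
open import Data.Fin.Properties using (any?) renaming (_≟_ to _≟ᶠ_)
open import Data.Fin.Subset using (Subset; ∣_∣; _∩_; ∁)
open import Data.Fin.Subset.Properties using (_∈?_; ∩-idem; ∣∁p∣≡n∸∣p∣)
open import Data.List.Base using (List; []; _∷_; length)
open import Data.List.Membership.Propositional using (_∈_)
open import Data.List.Relation.Unary.All using (All; []; _∷_)
open import Data.List.Relation.Unary.AllPairs using ([]; _∷_)
open import Data.List.Relation.Unary.Unique.Propositional using (Unique)
open import Data.Nat.Base
open import Data.Nat.Properties
open import Data.Vec.Base using (tabulate)
open import Function.Definitions using (Injective)
open import Relation.Binary.PropositionalEquality
open import Relation.Nullary.Decidable using (does; _×-dec_)

-- The vertex set is Fin n; the edge family is a duplicate-free list, so its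
-- length is the number of edges.

record KGraph (k n : ℕ) : Set where
  field
    edges   : List (Subset n)
    unique  : Unique edges
    uniform : All (λ e → ∣ e ∣ ≡ k) edges

open KGraph public

e : ∀ {k n} → KGraph k n → ℕ
e H = length (edges H)

image : ∀ {m n} → (Fin m → Fin n) → Subset m → Subset n
image f p = tabulate λ j → does (any? λ i → (i ∈? p) ×-dec (f i ≟ᶠ j))

-- A (not necessarily induced) copy of F in H, given by an isomorphism from F
-- onto a subgraph of H.

record Copy {k m n} (F : KGraph k m) (H : KGraph k n) : Set where
  field
    embed     : Fin m → Fin n
    injective : Injective _≡_ _≡_ embed
    edge      : ∀ {p} → p ∈ edges F → image embed p ∈ edges H

open Copy public

record Tiling {k m n} (F : KGraph k m) (H : KGraph k n) (size : ℕ) : Set where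
  field
    copy     : Fin size → Copy F H
    disjoint : ∀ {i j} → i ≢ j → ∀ u v → embed (copy i) u ≢ embed (copy j) v

initial : ∀ m → ℕ → Subset m
initial m j = tabulate λ i → toℕ i <ᵇ j

∣initial∣ : ∀ {m j} → j ≤ m → ∣ initial m j ∣ ≡ j
∣initial∣ {zero}  z≤n       = refl
∣initial∣ {suc m} z≤n       = ∣initial∣ {m} z≤n
∣initial∣ {suc m} (s≤s j≤m) = cong suc (∣initial∣ j≤m)

∣initial∩∁initial∣ : ∀ {m i j} → j ≤ i → i ≤ m →
                     ∣ initial m i ∩ ∁ (initial m j) ∣ ≡ i ∸ j
∣initial∩∁initial∣ {zero}  z≤n       z≤n       = refl
∣initial∩∁initial∣ {suc m} z≤n       z≤n       = ∣initial∩∁initial∣ {m} z≤n z≤n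
∣initial∩∁initial∣ {suc m} z≤n       (s≤s i≤m) = cong suc (∣initial∩∁initial∣ z≤n i≤m)
∣initial∩∁initial∣ {suc m} (s≤s j≤i) (s≤s i≤m) = ∣initial∩∁initial∣ j≤i i≤m

-- The two edges of Y k b are the first k and the last k of its 2k - b vertices.

firstEdge lastEdge : ∀ k b → Subset (2 * k ∸ b)
firstEdge k b = initial (2 * k ∸ b) k
lastEdge  k b = ∁ (initial (2 * k ∸ b) (k ∸ b))

private
  2k∸b : ∀ {k b} → b ≤ k → 2 * k ∸ b ≡ k + (k ∸ b)
  2k∸b {k} {b} b≤k = trans (cong (λ x → k + x ∸ b) (+-identityʳ k)) (+-∸-assoc k b≤k)

  k≤2k∸b : ∀ {k b} → b ≤ k → k ≤ 2 * k ∸ b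
  k≤2k∸b {k} {b} b≤k = subst (k ≤_) (sym (2k∸b b≤k)) (m≤m+n k (k ∸ b))

∣firstEdge∣ : ∀ {k b} → b ≤ k → ∣ firstEdge k b ∣ ≡ k
∣firstEdge∣ b≤k = ∣initial∣ (k≤2k∸b b≤k)

∣lastEdge∣ : ∀ {k b} → b ≤ k → ∣ lastEdge k b ∣ ≡ k
∣lastEdge∣ {k} {b} b≤k = begin
  ∣ lastEdge k b ∣                                 ≡⟨ ∣∁p∣≡n∸∣p∣ (initial (2 * k ∸ b) (k ∸ b)) ⟩
  2 * k ∸ b ∸ ∣ initial (2 * k ∸ b) (k ∸ b) ∣      ≡⟨ cong (2 * k ∸ b ∸_) (∣initial∣ (≤-trans (m∸n≤m k b) (k≤2k∸b b≤k))) ⟩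
  2 * k ∸ b ∸ (k ∸ b)                              ≡⟨ cong (_∸ (k ∸ b)) (2k∸b b≤k) ⟩
  k + (k ∸ b) ∸ (k ∸ b)                            ≡⟨ m+n∸n≡m k (k ∸ b) ⟩
  k                                                ∎
  where open ≡-Reasoning

∣firstEdge∩lastEdge∣ : ∀ {k b} → b ≤ k → ∣ firstEdge k b ∩ lastEdge k b ∣ ≡ b
∣firstEdge∩lastEdge∣ {k} {b} b≤k =
  trans (∣initial∩∁initial∣ (m∸n≤m k b) (k≤2k∸b b≤k)) (m∸[m∸n]≡n b≤k)

firstEdge≢lastEdge : ∀ {k b} → b < k → firstEdge k b ≢ lastEdge k b
firstEdge≢lastEdge {k} {b} b<k eq = <⇒≢ b<k (begin
  b                                     ≡⟨ ∣firstEdge∩lastEdge∣ (<⇒≤ b<k) ⟨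
  ∣ firstEdge k b ∩ lastEdge k b ∣      ≡⟨ cong (λ p → ∣ firstEdge k b ∩ p ∣) eq ⟨
  ∣ firstEdge k b ∩ firstEdge k b ∣     ≡⟨ cong ∣_∣ (∩-idem (firstEdge k b)) ⟩
  ∣ firstEdge k b ∣                     ≡⟨ ∣firstEdge∣ (<⇒≤ b<k) ⟩
  k                                     ∎)
  where open ≡-Reasoning

Y : ∀ k b → b < k → KGraph k (2 * k ∸ b)
Y k b b<k = record
  { edges   = firstEdge k b ∷ lastEdge k b ∷ []
  ; unique  = (firstEdge≢lastEdge b<k ∷ []) ∷ [] ∷ []
  ; uniform = ∣firstEdge∣ (<⇒≤ b<k) ∷ ∣lastEdge∣ (<⇒≤ b<k) ∷ []
  }

{-# OPTIONS --safe #-}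

-- Let m = 2k - b be the number of vertices of Y k b.
--
-- A family of k-sets on n ≥ k³ vertices, no two of which meet in exactly b
-- vertices, has at most C(n-1, k-1) members: for b = 0 this is the
-- Erdős–Ko–Rado bound (easy for large n), and b is lowered by averaging over
-- the links of the vertices.  The same bound in the link of a vertex v gives a
-- copy of Y k b through v that avoids any given set W with v ∉ W, as soon as
-- the degree of v exceeds (|W| + 1) C(n-2, k-2).
--
-- Call v high if its degree exceeds D = (m + 1) s C(n-2, k-2).  If there are s
-- high vertices, copies through them are chosen greedily.  If there are only
-- u < s, first choose s - u copies greedily among the edges without high
-- vertices, and then one copy through each high vertex.  The first phase cannot
-- get stuck: the high vertices meet at most C(n, k) - C(n-u, k) edges, the copies
-- chosen so far meet at most m (s-u-1) D edges without high vertices, and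
-- m D ≤ C(n-s+1, k-1) since n is large.
module Submission where

open import Defs
open import Algebra.Properties.CommutativeSemigroup using (interchange)
open import Data.Bool.Base using (Bool; if_then_else_)
import Data.Bool.Properties as Bool
open import Data.Fin.Base using (Fin; zero; suc; toℕ)
open import Data.Fin.Properties as Fin using (any?)
open import Data.Fin.Subset
  using (Subset; inside; outside; _∈_; _∉_; _⊆_; _∩_; _∪_; _-_; ∁; ⊤; ⊥; ∣_∣; ⁅_⁆; Nonempty)
open import Data.Fin.Subset.Properties
open import Data.List.Base as List using (List; []; _∷_; _++_; length)
import Data.List.Membership.DecPropositional as DecMembership
import Data.List.Membership.Propositional as List
open import Data.List.Membership.Propositional.Properties
  using (∈-lookup; ∈-map⁺; ∈-map⁻; ∈-++⁺ˡ; ∈-++⁺ʳ; ∈-++⁻)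
open import Data.List.Properties using (length-++; length-map; ++-assoc)
open import Data.List.Relation.Unary.All as All using ([]; _∷_)
import Data.List.Relation.Unary.All.Properties as All
open import Data.List.Relation.Unary.AllPairs using ([]; _∷_)
open import Data.List.Relation.Unary.Any using (here; there)
open import Data.List.Relation.Unary.Unique.Propositional using (Unique)
import Data.List.Relation.Unary.Unique.Propositional.Properties as Unique
open import Data.Nat using (ℕ; _+_; _*_; _∸_; _^_; _≤_; _<_; _≥_; _>_)
open import Data.Nat.Base using (zero; suc; pred; z≤n; s≤s; s≤s⁻¹; NonZero; >-nonZero)
open import Data.Nat.Combinatorics using (_C_; nCn≡1; nCk≡nC[n∸k]; nCk+nC[k+1]≡[n+1]C[k+1])
open import Data.Nat.Properties
open import Data.Nat.Tactic.RingSolver using (solve-∀)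
open import Data.Product using (∃; ∃₂; Σ; _×_; _,_; proj₁; proj₂)
open import Data.Sum.Base using (_⊎_; inj₁; inj₂; [_,_]′)
open import Data.Vec.Base using ([]; _∷_; here; there; tabulate)
open import Data.Vec.Properties using (lookup∘tabulate; lookup⇒[]=; []=⇒lookup; ≡-dec)
open import Function.Base using (_∘_; _$_)
open import Function.Definitions using (Injective)
open import Level using (0ℓ)
open import Relation.Binary.PropositionalEquality
open import Relation.Nullary using (Dec; yes; no; ¬_; contradiction)
open import Relation.Nullary.Decidable using (does; _×-dec_; ¬?; decidable-stable; dec-true)
open import Relation.Unary using (Pred; Decidable)

-- Counting families of subsets

-- Branching on the first vertex turns the binomial counts below into instances of Pascal's rule.
sumSubsets : ∀ {n} → (Subset n → ℕ) → ℕ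
sumSubsets {zero}  f = f []
sumSubsets {suc n} f = sumSubsets (f ∘ (inside ∷_)) + sumSubsets (f ∘ (outside ∷_))

sumOver : ∀ {n} → Subset n → (Fin n → ℕ) → ℕ
sumOver []            g = 0
sumOver (inside  ∷ p) g = g zero + sumOver p (g ∘ suc)
sumOver (outside ∷ p) g = sumOver p (g ∘ suc)

𝟙 : ∀ {A : Set} → Dec A → ℕ
𝟙 d = if does d then 1 else 0

count : ∀ {n} {P : Pred (Subset n) 0ℓ} → Decidable P → ℕ
count P? = sumSubsets (λ p → 𝟙 (P? p))

sumSubsets-mono : ∀ {n} {f g : Subset n → ℕ} → (∀ p → f p ≤ g p) → sumSubsets f ≤ sumSubsets g
sumSubsets-mono {zero}  f≤g = f≤g []
sumSubsets-mono {suc n} f≤g =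
  +-mono-≤ (sumSubsets-mono (f≤g ∘ (inside ∷_))) (sumSubsets-mono (f≤g ∘ (outside ∷_)))

sumSubsets-0 : ∀ n → sumSubsets {n} (λ _ → 0) ≡ 0
sumSubsets-0 zero    = refl
sumSubsets-0 (suc n) = cong₂ _+_ (sumSubsets-0 n) (sumSubsets-0 n)

sumSubsets-+ : ∀ {n} (f g : Subset n → ℕ) →
               sumSubsets (λ p → f p + g p) ≡ sumSubsets f + sumSubsets g
sumSubsets-+ {zero}  f g = refl
sumSubsets-+ {suc n} f g = trans
  (cong₂ _+_ (sumSubsets-+ (f ∘ (inside ∷_)) (g ∘ (inside ∷_)))
             (sumSubsets-+ (f ∘ (outside ∷_)) (g ∘ (outside ∷_))))
  (interchange +-commutativeSemigroup (sumSubsets (f ∘ (inside ∷_))) (sumSubsets (g ∘ (inside ∷_)))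
               (sumSubsets (f ∘ (outside ∷_))) (sumSubsets (g ∘ (outside ∷_))))

sumSubsets-* : ∀ {n} c (f : Subset n → ℕ) → sumSubsets (λ p → c * f p) ≡ c * sumSubsets f
sumSubsets-* {zero}  c f = refl
sumSubsets-* {suc n} c f = trans
  (cong₂ _+_ (sumSubsets-* c (f ∘ (inside ∷_))) (sumSubsets-* c (f ∘ (outside ∷_))))
  (sym (*-distribˡ-+ c (sumSubsets (f ∘ (inside ∷_))) (sumSubsets (f ∘ (outside ∷_)))))

-- Exchange of the two sums in a double count of incidences. The union bound `count-cover` and the
-- averaging in `count-avoiding` both rest on it.
sumSubsets-sumOver : ∀ {m n} (q : Subset m) (h : Fin m → Subset n → ℕ) →
                     sumSubsets (λ p → sumOver q (λ v → h v p)) ≡ sumOver q (λ v → sumSubsets (h v))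
sumSubsets-sumOver {n = n} [] h = sumSubsets-0 n
sumSubsets-sumOver (inside  ∷ q) h = trans
  (sumSubsets-+ (h zero) (λ p → sumOver q (λ v → h (suc v) p)))
  (cong (sumSubsets (h zero) +_) (sumSubsets-sumOver q (h ∘ suc)))
sumSubsets-sumOver (outside ∷ q) h = sumSubsets-sumOver q (h ∘ suc)

sumOver-≤ : ∀ {n} (q : Subset n) {g : Fin n → ℕ} {c} →
            (∀ {v} → v ∈ q → g v ≤ c) → sumOver q g ≤ ∣ q ∣ * c
sumOver-≤ []            g≤c = z≤n
sumOver-≤ (inside  ∷ q) g≤c = +-mono-≤ (g≤c here) (sumOver-≤ q (g≤c ∘ there))
sumOver-≤ (outside ∷ q) g≤c = sumOver-≤ q (g≤c ∘ there)

∈⇒≤sumOver : ∀ {n} {q : Subset n} {v} (g : Fin n → ℕ) → v ∈ q → g v ≤ sumOver q g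
∈⇒≤sumOver g here = m≤m+n _ _
∈⇒≤sumOver {q = inside  ∷ _} g (there v∈q) = m≤n⇒m≤o+n (g zero) (∈⇒≤sumOver (g ∘ suc) v∈q)
∈⇒≤sumOver {q = outside ∷ _} g (there v∈q) = ∈⇒≤sumOver (g ∘ suc) v∈q

𝟙-yes : ∀ {A : Set} (d : Dec A) → A → 1 ≤ 𝟙 d
𝟙-yes (yes _) _ = ≤-refl
𝟙-yes (no ¬a) a = contradiction a ¬a

𝟙-≤ : ∀ {A : Set} (d : Dec A) {x} → (A → 1 ≤ x) → 𝟙 d ≤ x
𝟙-≤ (yes a) 1≤x = 1≤x a
𝟙-≤ (no _)  _   = z≤n

∣∩∣≤sumOver : ∀ {n} (q p : Subset n) → ∣ q ∩ p ∣ ≤ sumOver q (λ v → 𝟙 (v ∈? p))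
∣∩∣≤sumOver []            []            = z≤n
∣∩∣≤sumOver (inside  ∷ q) (inside  ∷ p) = s≤s (∣∩∣≤sumOver q p)
∣∩∣≤sumOver (inside  ∷ q) (outside ∷ p) = ∣∩∣≤sumOver q p
∣∩∣≤sumOver (outside ∷ q) (inside  ∷ p) = ∣∩∣≤sumOver q p
∣∩∣≤sumOver (outside ∷ q) (outside ∷ p) = ∣∩∣≤sumOver q p

module _ {n : ℕ} {P Q : Pred (Subset n) 0ℓ} (P? : Decidable P) (Q? : Decidable Q) where

  count-mono : (∀ {p} → P p → Q p) → count P? ≤ count Q?
  count-mono P⇒Q = sumSubsets-mono λ p → 𝟙-≤ (P? p) (𝟙-yes (Q? p) ∘ P⇒Q)

  count-split : ∀ {R : Pred (Subset n) 0ℓ} (R? : Decidable R) →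
                (∀ {p} → P p → Q p ⊎ R p) → count P? ≤ count Q? + count R?
  count-split R? P⇒Q⊎R = ≤-trans
    (sumSubsets-mono λ p → 𝟙-≤ (P? p) $
      [ m≤n⇒m≤n+o _ ∘ 𝟙-yes (Q? p) , m≤n⇒m≤o+n _ ∘ 𝟙-yes (R? p) ]′ ∘ P⇒Q⊎R)
    (≤-reflexive (sumSubsets-+ (𝟙 ∘ Q?) (𝟙 ∘ R?)))

count-cong : ∀ {n} {P Q : Pred (Subset n) 0ℓ} (P? : Decidable P) (Q? : Decidable Q) →
             (∀ {p} → P p → Q p) → (∀ {p} → Q p → P p) → count P? ≡ count Q?
count-cong P? Q? P⇒Q Q⇒P = ≤-antisym (count-mono P? Q? P⇒Q) (count-mono Q? P? Q⇒P)

count-∅ : ∀ {n} {P : Pred (Subset n) 0ℓ} (P? : Decidable P) → (∀ {p} → ¬ P p) → count P? ≡ 0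
count-∅ {n} P? ¬P = n≤0⇒n≡0 $ ≤-trans
  (sumSubsets-mono λ p → 𝟙-≤ (P? p) λ Pp → contradiction Pp ¬P)
  (≤-reflexive (sumSubsets-0 n))

≤sumSubsets : ∀ {n} (f : Subset n → ℕ) p → f p ≤ sumSubsets f
≤sumSubsets f []            = ≤-refl
≤sumSubsets f (inside  ∷ p) = m≤n⇒m≤n+o _ (≤sumSubsets (f ∘ (inside ∷_)) p)
≤sumSubsets f (outside ∷ p) = m≤n⇒m≤o+n _ (≤sumSubsets (f ∘ (outside ∷_)) p)

count-disjoint : ∀ {n} {P Q R : Pred (Subset n) 0ℓ} (P? : Decidable P) (Q? : Decidable Q) (R? : Decidable R) →
                 (∀ {p} → P p → R p) → (∀ {p} → Q p → R p) → (∀ {p} → P p → ¬ Q p) →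
                 count P? + count Q? ≤ count R?
count-disjoint P? Q? R? P⇒R Q⇒R P⇒¬Q = ≤-trans
  (≤-reflexive (sym (sumSubsets-+ (𝟙 ∘ P?) (𝟙 ∘ Q?)))) (sumSubsets-mono pointwise)
  where
  pointwise : ∀ p → 𝟙 (P? p) + 𝟙 (Q? p) ≤ 𝟙 (R? p)
  pointwise p with P? p | Q? p
  ... | yes Pp | yes Qp = contradiction Qp (P⇒¬Q Pp)
  ... | yes Pp | no  _  = 𝟙-yes (R? p) (P⇒R Pp)
  ... | no  _  | yes Qp = 𝟙-yes (R? p) (Q⇒R Qp)
  ... | no  _  | no  _  = z≤n

-- Union bound: every counted set is charged to some vertex of `q`, and then the order of summation
-- is exchanged.
count-cover : ∀ {n} {P : Pred (Subset n) 0ℓ} {Q : Fin n → Pred (Subset n) 0ℓ}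
              (P? : Decidable P) (Q? : ∀ v → Decidable (Q v)) (q : Subset n) →
              (∀ {p} → P p → ∃ λ v → v ∈ q × Q v p) → count P? ≤ sumOver q (λ v → count (Q? v))
count-cover P? Q? q cover = ≤-trans
  (sumSubsets-mono λ p → 𝟙-≤ (P? p) λ Pp → let v , v∈q , Qvp = cover Pp in
    ≤-trans (𝟙-yes (Q? v p) Qvp) (∈⇒≤sumOver (λ v → 𝟙 (Q? v p)) v∈q))
  (≤-reflexive (sumSubsets-sumOver q (λ v p → 𝟙 (Q? v p))))

count-cover-≤ : ∀ {n} {P : Pred (Subset n) 0ℓ} {Q : Fin n → Pred (Subset n) 0ℓ} {c}
                (P? : Decidable P) (Q? : ∀ v → Decidable (Q v)) (q : Subset n) →
                (∀ {p} → P p → ∃ λ v → v ∈ q × Q v p) →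
                (∀ {v} → v ∈ q → count (Q? v) ≤ c) → count P? ≤ ∣ q ∣ * c
count-cover-≤ P? Q? q cover Q≤c = ≤-trans (count-cover P? Q? q cover) (sumOver-≤ q Q≤c)

-- Numbers of subsets and supersets of a given size

nC0≡1 : ∀ n → n C 0 ≡ 1
nC0≡1 n = trans (nCk≡nC[n∸k] {k = 0} {n = n} z≤n) (nCn≡1 n)

count-⊆ : ∀ {n} (q : Subset n) r → count (λ p → p ⊆? q ×-dec ∣ p ∣ ≟ r) ≡ ∣ q ∣ C r
count-⊆ [] zero    = refl
count-⊆ [] (suc r) = refl
count-⊆ (outside ∷ q) r = cong₂ _+_
  (count-∅ (λ p → (inside ∷ p) ⊆? (outside ∷ q) ×-dec ∣ inside ∷ p ∣ ≟ r)
    λ (p⊆q , _) → contradiction (p⊆q here) λ ())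
  (trans (count-cong (λ p → (outside ∷ p) ⊆? (outside ∷ q) ×-dec ∣ outside ∷ p ∣ ≟ r)
                     (λ p → p ⊆? q ×-dec ∣ p ∣ ≟ r)
                     (λ (p⊆q , eq) → drop-∷-⊆ p⊆q , eq) (λ (p⊆q , eq) → out⊆ p⊆q , eq))
         (count-⊆ q r))
count-⊆ (inside ∷ q) zero = trans
  (cong₂ _+_
    (count-∅ (λ p → (inside ∷ p) ⊆? (inside ∷ q) ×-dec ∣ inside ∷ p ∣ ≟ 0) λ ())
    (trans (count-cong (λ p → (outside ∷ p) ⊆? (inside ∷ q) ×-dec ∣ outside ∷ p ∣ ≟ 0)
                       (λ p → p ⊆? q ×-dec ∣ p ∣ ≟ 0)
                       (λ (p⊆q , eq) → drop-∷-⊆ p⊆q , eq) (λ (p⊆q , eq) → out⊆ p⊆q , eq))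
           (count-⊆ q 0)))
  (trans (nC0≡1 ∣ q ∣) (sym (nC0≡1 (suc ∣ q ∣))))
count-⊆ (inside ∷ q) (suc r) = trans
  (cong₂ _+_
    (trans (count-cong (λ p → (inside ∷ p) ⊆? (inside ∷ q) ×-dec ∣ inside ∷ p ∣ ≟ suc r)
                       (λ p → p ⊆? q ×-dec ∣ p ∣ ≟ r)
                       (λ (p⊆q , eq) → drop-∷-⊆ p⊆q , suc-injective eq)
                       (λ (p⊆q , eq) → in⊆in p⊆q , cong suc eq))
           (count-⊆ q r))
    (trans (count-cong (λ p → (outside ∷ p) ⊆? (inside ∷ q) ×-dec ∣ outside ∷ p ∣ ≟ suc r)
                       (λ p → p ⊆? q ×-dec ∣ p ∣ ≟ suc r)
                       (λ (p⊆q , eq) → drop-∷-⊆ p⊆q , eq) (λ (p⊆q , eq) → out⊆ p⊆q , eq))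
           (count-⊆ q (suc r))))
  (nCk+nC[k+1]≡[n+1]C[k+1] ∣ q ∣ r)

-- Removing `B` leaves an arbitrary `r`-subset of the complement. The size is written as `∣ B ∣ + r`
-- so that the recursion can match on `r` without subtraction.
count-⊇ : ∀ {n} (B : Subset n) r →
          count (λ p → B ⊆? p ×-dec ∣ p ∣ ≟ ∣ B ∣ + r) ≡ ∣ ∁ B ∣ C r
count-⊇ [] zero    = refl
count-⊇ [] (suc r) = refl
count-⊇ (inside ∷ B) r = trans
  (cong₂ _+_
    (trans (count-cong (λ p → (inside ∷ B) ⊆? (inside ∷ p) ×-dec ∣ inside ∷ p ∣ ≟ ∣ inside ∷ B ∣ + r)
                       (λ p → B ⊆? p ×-dec ∣ p ∣ ≟ ∣ B ∣ + r)
                       (λ (B⊆p , eq) → drop-∷-⊆ B⊆p , suc-injective eq)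
                       (λ (B⊆p , eq) → in⊆in B⊆p , cong suc eq))
           (count-⊇ B r))
    (count-∅ (λ p → (inside ∷ B) ⊆? (outside ∷ p) ×-dec ∣ outside ∷ p ∣ ≟ ∣ inside ∷ B ∣ + r)
      λ (B⊆p , _) → contradiction (B⊆p here) λ ()))
  (+-identityʳ _)
count-⊇ (outside ∷ B) zero = trans
  (cong₂ _+_
    -- Taking the first vertex, which is outside `B`, would leave fewer than `∣ B ∣` vertices to
    -- cover `B`.
    (count-∅ (λ p → (outside ∷ B) ⊆? (inside ∷ p) ×-dec ∣ inside ∷ p ∣ ≟ ∣ outside ∷ B ∣ + 0)
      λ (B⊆p , eq) → contradiction (p⊆q⇒∣p∣≤∣q∣ (drop-∷-⊆ B⊆p))
                                   (<⇒≱ (≤-reflexive (trans eq (+-identityʳ _)))))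
    (trans (count-cong (λ p → (outside ∷ B) ⊆? (outside ∷ p) ×-dec ∣ outside ∷ p ∣ ≟ ∣ outside ∷ B ∣ + 0)
                       (λ p → B ⊆? p ×-dec ∣ p ∣ ≟ ∣ B ∣ + 0)
                       (λ (B⊆p , eq) → drop-∷-⊆ B⊆p , eq) (λ (B⊆p , eq) → out⊆ B⊆p , eq))
           (count-⊇ B 0)))
  (trans (nC0≡1 ∣ ∁ B ∣) (sym (nC0≡1 (suc ∣ ∁ B ∣))))
count-⊇ (outside ∷ B) (suc r) = trans
  (cong₂ _+_
    (trans (count-cong (λ p → (outside ∷ B) ⊆? (inside ∷ p) ×-dec ∣ inside ∷ p ∣ ≟ ∣ outside ∷ B ∣ + suc r)
                       (λ p → B ⊆? p ×-dec ∣ p ∣ ≟ ∣ B ∣ + r)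
                       (λ (B⊆p , eq) → drop-∷-⊆ B⊆p , suc-injective (trans eq (+-suc _ r)))
                       (λ (B⊆p , eq) → out⊆ B⊆p , trans (cong suc eq) (sym (+-suc _ r))))
           (count-⊇ B r))
    (trans (count-cong (λ p → (outside ∷ B) ⊆? (outside ∷ p) ×-dec ∣ outside ∷ p ∣ ≟ ∣ outside ∷ B ∣ + suc r)
                       (λ p → B ⊆? p ×-dec ∣ p ∣ ≟ ∣ B ∣ + suc r)
                       (λ (B⊆p , eq) → drop-∷-⊆ B⊆p , eq) (λ (B⊆p , eq) → out⊆ B⊆p , eq))
           (count-⊇ B (suc r))))
  (nCk+nC[k+1]≡[n+1]C[k+1] ∣ ∁ B ∣ r)

-- Families with a forbidden intersection size

-- Induction on `n` through Pascal's rule. The identity stands in for the quotient of C(n+1, r+1)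
-- and C(n, r), so that the averaging arguments run in `ℕ` without division.
absorption : ∀ n r → suc r * (suc n C suc r) ≡ suc n * (n C r)
absorption zero    zero    = refl
absorption zero    (suc r) = *-zeroʳ (suc (suc r))
absorption (suc n) r = begin
  suc r * (suc (suc n) C suc r)                        ≡⟨ cong (suc r *_) (nCk+nC[k+1]≡[n+1]C[k+1] (suc n) r) ⟨
  suc r * (suc n C r + suc n C suc r)                  ≡⟨ *-distribˡ-+ (suc r) (suc n C r) _ ⟩
  suc n C r + r * (suc n C r) + suc r * (suc n C suc r) ≡⟨ +-assoc (suc n C r) _ _ ⟩
  suc n C r + (r * (suc n C r) + suc r * (suc n C suc r)) ≡⟨ cong (suc n C r +_) (rest r) ⟩
  suc n C r + suc n * (suc n C r)                      ∎
  where
  open ≡-Reasoning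
  -- The induction hypothesis applies to both summands, and Pascal's rule recombines them; for
  -- `r = 0` the first summand vanishes.
  rest : ∀ r → r * (suc n C r) + suc r * (suc n C suc r) ≡ suc n * (suc n C r)
  rest zero    = trans (absorption n zero) (cong (suc n *_) (trans (nC0≡1 n) (sym (nC0≡1 (suc n)))))
  rest (suc r) = begin
    suc r * (suc n C suc r) + suc (suc r) * (suc n C suc (suc r))  ≡⟨ cong₂ _+_ (absorption n r) (absorption n (suc r)) ⟩
    suc n * (n C r) + suc n * (n C suc r)                          ≡⟨ *-distribˡ-+ (suc n) (n C r) _ ⟨
    suc n * (n C r + n C suc r)                                    ≡⟨ cong (suc n *_) (nCk+nC[k+1]≡[n+1]C[k+1] n r) ⟩
    suc n * (suc n C suc r)                                        ∎

∣p∪⁅v⁆∣ : ∀ {n} {p : Subset n} {v} → v ∉ p → ∣ p ∪ ⁅ v ⁆ ∣ ≡ suc ∣ p ∣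
∣p∪⁅v⁆∣ {p = inside  ∷ p} {zero}  v∉p = contradiction here v∉p
∣p∪⁅v⁆∣ {p = outside ∷ p} {zero}  v∉p = cong (suc ∘ ∣_∣) (∪-identityʳ p)
∣p∪⁅v⁆∣ {p = inside  ∷ p} {suc v} v∉p = cong suc (∣p∪⁅v⁆∣ (v∉p ∘ there))
∣p∪⁅v⁆∣ {p = outside ∷ p} {suc v} v∉p = ∣p∪⁅v⁆∣ (v∉p ∘ there)

∣∁p∣≡1+∣∁[p∪⁅v⁆]∣ : ∀ {n} {p : Subset n} {v} → v ∉ p → ∣ ∁ p ∣ ≡ suc ∣ ∁ (p ∪ ⁅ v ⁆) ∣
∣∁p∣≡1+∣∁[p∪⁅v⁆]∣ {p = inside  ∷ p} {zero}  v∉p = contradiction here v∉p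
∣∁p∣≡1+∣∁[p∪⁅v⁆]∣ {p = outside ∷ p} {zero}  v∉p = cong (suc ∘ ∣_∣ ∘ ∁) (sym (∪-identityʳ p))
∣∁p∣≡1+∣∁[p∪⁅v⁆]∣ {p = inside  ∷ p} {suc v} v∉p = ∣∁p∣≡1+∣∁[p∪⁅v⁆]∣ (v∉p ∘ there)
∣∁p∣≡1+∣∁[p∪⁅v⁆]∣ {p = outside ∷ p} {suc v} v∉p = cong suc (∣∁p∣≡1+∣∁[p∪⁅v⁆]∣ (v∉p ∘ there))

p∪⁅v⁆⊆q : ∀ {n} {p q : Subset n} {v} → p ⊆ q → v ∈ q → p ∪ ⁅ v ⁆ ⊆ q
p∪⁅v⁆⊆q {p = p} {q} {v} p⊆q v∈q =
  [ p⊆q , (λ x∈⁅v⁆ → subst (_∈ q) (sym (x∈⁅y⁆⇒x≡y v x∈⁅v⁆)) v∈q) ]′ ∘ x∈p∪q⁻ p ⁅ v ⁆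

∣p∩q∣+∣∁p∩q∣≡∣q∣ : ∀ {n} (p q : Subset n) → ∣ p ∩ q ∣ + ∣ ∁ p ∩ q ∣ ≡ ∣ q ∣
∣p∩q∣+∣∁p∩q∣≡∣q∣ []            []            = refl
∣p∩q∣+∣∁p∩q∣≡∣q∣ (inside  ∷ p) (inside  ∷ q) = cong suc (∣p∩q∣+∣∁p∩q∣≡∣q∣ p q)
∣p∩q∣+∣∁p∩q∣≡∣q∣ (outside ∷ p) (inside  ∷ q) = trans (+-suc ∣ p ∩ q ∣ _) (cong suc (∣p∩q∣+∣∁p∩q∣≡∣q∣ p q))
∣p∩q∣+∣∁p∩q∣≡∣q∣ (inside  ∷ p) (outside ∷ q) = ∣p∩q∣+∣∁p∩q∣≡∣q∣ p q
∣p∩q∣+∣∁p∩q∣≡∣q∣ (outside ∷ p) (outside ∷ q) = ∣p∩q∣+∣∁p∩q∣≡∣q∣ p q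

p⊆q⇒p∩q≡p : ∀ {n} {p q : Subset n} → p ⊆ q → p ∩ q ≡ p
p⊆q⇒p∩q≡p {p = p} {q} p⊆q = ⊆-antisym (p∩q⊆p p q) (λ x∈p → x∈p∩q⁺ (x∈p , p⊆q x∈p))

∣∁p∩q∣≡r : ∀ {n} {p q : Subset n} {r} → p ⊆ q → ∣ q ∣ ≡ ∣ p ∣ + r → ∣ ∁ p ∩ q ∣ ≡ r
∣∁p∩q∣≡r {p = p} {q} p⊆q ∣q∣≡ = +-cancelˡ-≡ ∣ p ∣ _ _ $
  trans (cong (λ x → ∣ x ∣ + ∣ ∁ p ∩ q ∣) (sym (p⊆q⇒p∩q≡p p⊆q))) (trans (∣p∩q∣+∣∁p∩q∣≡∣q∣ p q) ∣q∣≡)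

-- The intersection contains `B` but differs from it in size, so it cannot equal `B`. A finite
-- search makes the extra vertex explicit.
intersect-outside : ∀ {n} {B p q : Subset n} → B ⊆ p → B ⊆ q → ∣ p ∩ q ∣ ≢ ∣ B ∣ →
                    ∃ λ v → v ∈ ∁ B ∩ q × v ∈ p
intersect-outside {B = B} {p} {q} B⊆p B⊆q ∣p∩q∣≢∣B∣ =
  decidable-stable (any? λ v → v ∈? (∁ B ∩ q) ×-dec v ∈? p) λ none →
    ∣p∩q∣≢∣B∣ $ cong ∣_∣ $ ⊆-antisym
      (λ {v} v∈p∩q → let v∈p , v∈q = x∈p∩q⁻ p q v∈p∩q in
        x∉∁p⇒x∈p λ v∈∁B → none (v , x∈p∩q⁺ (v∈∁B , v∈q) , v∈p))
      (λ v∈B → x∈p∩q⁺ (B⊆p v∈B , B⊆q v∈B))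

-- C(N-1, r-1), read as 0 when r = 0.
codegree : ℕ → ℕ → ℕ
codegree N zero    = 0
codegree N (suc r) = pred N C r

-- Absorption in terms of `N` and `r` themselves. The convention for `codegree` makes both sides
-- vanish at `r = 0`, so the degree estimates need no case distinction there.
codegree-C : ∀ N r → N * codegree N r ≤ r * (N C r)
codegree-C N       zero    = ≤-reflexive (*-zeroʳ N)
codegree-C zero    (suc r) = z≤n
codegree-C (suc N) (suc r) = ≤-reflexive (sym (absorption N r))

module _ {n : ℕ} {P : Pred (Subset n) 0ℓ} (P? : Decidable P) where

  count-⊇-≤ : ∀ B {r N} → (∀ {p} → P p → B ⊆ p × ∣ p ∣ ≡ ∣ B ∣ + r) → ∣ ∁ B ∣ ≡ N → count P? ≤ N C r
  count-⊇-≤ B {r} shape refl = ≤-trans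
    (count-mono P? (λ p → B ⊆? p ×-dec ∣ p ∣ ≟ ∣ B ∣ + r) shape) (≤-reflexive (count-⊇ B r))

  -- The members contain `B` and two further distinct vertices, so `r - 1` vertices remain to be
  -- chosen from `N - 1`. For `r = 0` a member is too small to hold both vertices, and there are
  -- none.
  count-codegree : ∀ B {r N v w} → (∀ {p} → P p → (B ⊆ p × ∣ p ∣ ≡ ∣ B ∣ + suc r) × v ∈ p × w ∈ p) →
                   ∣ ∁ B ∣ ≡ suc N → v ∉ B → w ∉ B ∪ ⁅ v ⁆ → count P? ≤ codegree N r
  count-codegree B {zero} shape eq v∉B w∉B∪v = ≤-reflexive $ count-∅ P? λ {p} Pp →
    let (B⊆p , ∣p∣≡) , v∈p , w∈p = shape Pp in
    <⇒≱ (≤-reflexive (begin-equality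
      suc ∣ p ∣              ≡⟨ cong suc (trans ∣p∣≡ (+-comm ∣ B ∣ 1)) ⟩
      suc (suc ∣ B ∣)        ≡⟨ cong suc (∣p∪⁅v⁆∣ v∉B) ⟨
      suc ∣ B ∪ ⁅ _ ⁆ ∣      ≡⟨ ∣p∪⁅v⁆∣ w∉B∪v ⟨
      ∣ (B ∪ ⁅ _ ⁆) ∪ ⁅ _ ⁆ ∣  ∎))
      (p⊆q⇒∣p∣≤∣q∣ (p∪⁅v⁆⊆q (p∪⁅v⁆⊆q B⊆p v∈p) w∈p))
    where open ≤-Reasoning
  count-codegree B {suc r} {N} {v} {w} shape eq v∉B w∉B∪v =
    count-⊇-≤ ((B ∪ ⁅ v ⁆) ∪ ⁅ w ⁆)
      (λ {p} Pp → let (B⊆p , ∣p∣≡) , v∈p , w∈p = shape Pp in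
        p∪⁅v⁆⊆q (p∪⁅v⁆⊆q B⊆p v∈p) w∈p ,
        (begin
          ∣ p ∣                              ≡⟨ ∣p∣≡ ⟩
          ∣ B ∣ + suc (suc r)                ≡⟨ +-suc _ (suc r) ⟩
          suc (∣ B ∣ + suc r)                ≡⟨ cong suc (+-suc _ r) ⟩
          suc (suc ∣ B ∣) + r                ≡⟨ cong (λ x → suc x + r) (∣p∪⁅v⁆∣ v∉B) ⟨
          suc ∣ B ∪ ⁅ v ⁆ ∣ + r              ≡⟨ cong (_+ r) (∣p∪⁅v⁆∣ w∉B∪v) ⟨
          ∣ (B ∪ ⁅ v ⁆) ∪ ⁅ w ⁆ ∣ + r        ∎))
      (cong pred (suc-injective (begin
        suc (suc ∣ ∁ ((B ∪ ⁅ v ⁆) ∪ ⁅ w ⁆) ∣)  ≡⟨ cong suc (∣∁p∣≡1+∣∁[p∪⁅v⁆]∣ w∉B∪v) ⟨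
        suc ∣ ∁ (B ∪ ⁅ v ⁆) ∣                  ≡⟨ ∣∁p∣≡1+∣∁[p∪⁅v⁆]∣ v∉B ⟨
        ∣ ∁ B ∣                                ≡⟨ eq ⟩
        suc N                                  ∎)))
    where open ≡-Reasoning

-- Either all members share a vertex outside B, or every vertex v outside B is
-- missed by a member q; in the latter case every member through v also meets
-- q \ B, so v has small degree, and a fixed member meets all the others.
count-intersecting : ∀ {n} {P : Pred (Subset n) 0ℓ} (P? : Decidable P) B {r N} →
  (∀ {p} → P p → B ⊆ p × ∣ p ∣ ≡ ∣ B ∣ + suc r) →
  (∀ {p q} → P p → P q → ∣ p ∩ q ∣ ≢ ∣ B ∣) →
  suc r ^ 3 ≤ N → ∣ ∁ B ∣ ≡ suc N → count P? ≤ N C r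
count-intersecting P? B {r} {N} shape intersecting r³≤N ∣∁B∣≡
  with any? (λ v → ¬? (v ∈? B) ×-dec ¬? (anySubset? (λ p → P? p ×-dec ¬? (v ∈? p))))
... | yes (v , v∉B , v∈all) = count-⊇-≤ P? (B ∪ ⁅ v ⁆)
  (λ {p} Pp → let B⊆p , ∣p∣≡ = shape Pp in
    p∪⁅v⁆⊆q B⊆p (decidable-stable (v ∈? p) λ v∉p → v∈all (p , Pp , v∉p)) ,
    trans ∣p∣≡ (trans (+-suc _ r) (cong (_+ r) (sym (∣p∪⁅v⁆∣ v∉B)))))
  (suc-injective (trans (sym (∣∁p∣≡1+∣∁[p∪⁅v⁆]∣ v∉B)) ∣∁B∣≡))
... | no no-common with anySubset? P?
...   | no empty = ≤-trans (≤-reflexive (count-∅ P? λ {p} Pp → empty (p , Pp))) z≤n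
-- There are `suc r` vertices of `E` outside `B`, each of degree at most `suc r * codegree N r`.
-- Multiplying by `N` allows absorption to compare this with `N C r`; the total factor is at most
-- `suc r ^ 3`, hence at most `N`.
...   | yes (E , PE) = *-cancelˡ-≤ N {{>-nonZero (≤-trans (m^n>0 (suc r) 3) r³≤N)}} (begin
  N * count P?                                    ≤⟨ *-monoʳ-≤ N (count-cover-≤ P? (λ v p → P? p ×-dec v ∈? p) (∁ B ∩ E)
                                                       (λ {p} Pp → let v , v∈ , v∈p = meet Pp PE in v , v∈ , Pp , v∈p)
                                                       (degree ∘ x∈∁p⇒x∉p ∘ p∩q⊆p (∁ B) E)) ⟩
  N * (∣ ∁ B ∩ E ∣ * (suc r * codegree N r))      ≡⟨ cong (λ x → N * (x * (suc r * codegree N r))) (size PE) ⟩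
  N * (suc r * (suc r * codegree N r))            ≡⟨ comm₁ N (suc r) (codegree N r) ⟩
  suc r * suc r * (N * codegree N r)              ≤⟨ *-monoʳ-≤ (suc r * suc r) (codegree-C N r) ⟩
  suc r * suc r * (r * (N C r))                   ≤⟨ *-monoʳ-≤ (suc r * suc r) (*-monoˡ-≤ (N C r) (n≤1+n r)) ⟩
  suc r * suc r * (suc r * (N C r))               ≡⟨ comm₂ (suc r) (N C r) ⟩
  suc r ^ 3 * (N C r)                             ≤⟨ *-monoˡ-≤ (N C r) r³≤N ⟩
  N * (N C r)                                     ∎)
  where
  open ≤-Reasoning
  comm₁ : ∀ a b c → a * (b * (b * c)) ≡ b * b * (a * c)
  comm₁ = solve-∀
  comm₂ : ∀ a c → a * a * (a * c) ≡ a * (a * (a * 1)) * c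
  comm₂ = solve-∀
  meet : ∀ {p q} → _ → _ → ∃ λ v → v ∈ ∁ B ∩ q × v ∈ p
  meet Pp Pq = intersect-outside (proj₁ (shape Pp)) (proj₁ (shape Pq)) (intersecting Pp Pq)
  size : ∀ {q} → _ → ∣ ∁ B ∩ q ∣ ≡ suc r
  size Pq = ∣∁p∩q∣≡r (proj₁ (shape Pq)) (proj₂ (shape Pq))
  degree : ∀ {v} → v ∉ B → count (λ p → P? p ×-dec v ∈? p) ≤ suc r * codegree N r
  degree {v} v∉B with anySubset? (λ p → P? p ×-dec ¬? (v ∈? p))
  ... | no v∈all = contradiction (v , v∉B , v∈all) no-common
  ... | yes (q , Pq , v∉q) = ≤-trans
    (count-cover-≤ (λ p → P? p ×-dec v ∈? p) (λ w p → (P? p ×-dec v ∈? p) ×-dec w ∈? p) (∁ B ∩ q)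
      (λ (Pp , v∈p) → let w , w∈ , w∈p = meet Pp Pq in w , w∈ , (Pp , v∈p) , w∈p)
      -- The vertex `w` lies in `q` while `v` does not, so they are distinct and the codegree bound
      -- applies.
      (λ {w} w∈ → let w∈∁B , w∈q = x∈p∩q⁻ (∁ B) q w∈ in
        count-codegree (λ p → (P? p ×-dec v ∈? p) ×-dec w ∈? p) B
          (λ ((Pp , v∈p) , w∈p) → shape Pp , v∈p , w∈p) ∣∁B∣≡ v∉B
          ([ x∈∁p⇒x∉p w∈∁B , (λ w∈⁅v⁆ → v∉q (subst (_∈ q) (x∈⁅y⁆⇒x≡y v w∈⁅v⁆) w∈q)) ]′ ∘ x∈p∪q⁻ B ⁅ v ⁆)))
    (≤-reflexive (cong (_* codegree N r) (size Pq)))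

-- Averaging over the vertices v outside B replaces B by B ∪ {v} and i by i - 1.
count-avoiding : ∀ {n} i {r} {P : Pred (Subset n) 0ℓ} (P? : Decidable P) B {N} →
  (∀ {p} → P p → B ⊆ p × ∣ p ∣ ≡ ∣ B ∣ + suc r) →
  (∀ {p q} → P p → P q → ∣ p ∩ q ∣ ≢ ∣ B ∣ + i) →
  i ≤ r → suc r ^ 3 ≤ N → ∣ ∁ B ∣ ≡ suc N → count P? ≤ N C r
count-avoiding zero P? B shape avoiding i≤r =
  count-intersecting P? B shape (λ Pp Pq eq → avoiding Pp Pq (trans eq (sym (+-identityʳ _))))
count-avoiding (suc i) {suc r} P? B {suc N} shape avoiding (s≤s i≤r) r³≤N ∣∁B∣≡ =
  -- Every member has `R` vertices outside `B`, so averaging bounds the count by (N+2)/(r+2) times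
  -- C(N, r). By absorption this is at most C(N+1, r+1) once (N+2)(r+1) ≤ (r+2)(N+1).
  *-cancelˡ-≤ (R * suc N) (begin
    R * suc N * count P?            ≡⟨ comm₁ R (suc N) (count P?) ⟩
    suc N * (R * count P?)          ≤⟨ *-monoʳ-≤ (suc N) average ⟩
    suc N * (suc (suc N) * (N C r)) ≡⟨ comm₂ (suc N) (suc (suc N)) (N C r) ⟩
    suc (suc N) * (suc N * (N C r)) ≡⟨ cong (suc (suc N) *_) (absorption N r) ⟨
    suc (suc N) * (suc r * (suc N C suc r)) ≡⟨ *-assoc (suc (suc N)) (suc r) _ ⟨
    suc (suc N) * suc r * (suc N C suc r) ≤⟨ *-monoˡ-≤ (suc N C suc r) ratio ⟩
    R * suc N * (suc N C suc r)     ∎)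
  where
  open ≤-Reasoning
  R = suc (suc r)
  comm₁ : ∀ a b c → a * b * c ≡ b * (a * c)
  comm₁ = solve-∀
  comm₂ : ∀ a b c → a * (b * c) ≡ b * (a * c)
  comm₂ = solve-∀
  -- Lowering the base of the cube by one lowers the cube by at least one, which pays for the vertex
  -- that the complement loses to `B`.
  r<N : suc r ^ 3 ≤ N
  r<N = s≤s⁻¹ (<-≤-trans (^-monoˡ-< 3 (n<1+n (suc r))) r³≤N)
  ratio : suc (suc N) * suc r ≤ R * suc N
  ratio = begin
    suc r + suc N * suc r  ≤⟨ +-monoˡ-≤ _ (m≤n⇒m≤1+n (≤-trans (m≤m^n (suc r) 3) r<N)) ⟩
    suc N + suc N * suc r  ≡⟨ cong (suc N +_) (*-comm (suc N) (suc r)) ⟩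
    R * suc N              ∎
    where
    m≤m^n : ∀ a b .{{_ : NonZero a}} .{{_ : NonZero b}} → a ≤ a ^ b
    m≤m^n a (suc b) = ≤-trans (≤-reflexive (sym (*-identityʳ a))) (*-monoʳ-≤ a (m^n>0 a b))
  degree : ∀ {v} → v ∈ ∁ B → count (λ p → P? p ×-dec v ∈? p) ≤ N C r
  degree {v} v∈∁B = count-avoiding i (λ p → P? p ×-dec v ∈? p) (B ∪ ⁅ v ⁆)
    (λ (Pp , v∈p) → p∪⁅v⁆⊆q (proj₁ (shape Pp)) v∈p ,
      trans (proj₂ (shape Pp)) (trans (+-suc _ (suc r)) (cong (_+ suc r) (sym ∣B∪v∣))))
    (λ (Pp , _) (Pq , _) eq → avoiding Pp Pq (trans eq (trans (cong (_+ i) ∣B∪v∣) (sym (+-suc _ i)))))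
    i≤r r<N (suc-injective (trans (sym (∣∁p∣≡1+∣∁[p∪⁅v⁆]∣ (x∈∁p⇒x∉p v∈∁B))) ∣∁B∣≡))
    where ∣B∪v∣ = ∣p∪⁅v⁆∣ (x∈∁p⇒x∉p v∈∁B)
  average : R * count P? ≤ suc (suc N) * (N C r)
  average = begin
    R * count P?                                                   ≡⟨ sumSubsets-* R (𝟙 ∘ P?) ⟨
    sumSubsets (λ p → R * 𝟙 (P? p))                                ≤⟨ sumSubsets-mono pointwise ⟩
    sumSubsets (λ p → sumOver (∁ B) (λ v → 𝟙 (P? p ×-dec v ∈? p))) ≡⟨ sumSubsets-sumOver (∁ B) (λ v p → 𝟙 (P? p ×-dec v ∈? p)) ⟩
    sumOver (∁ B) (λ v → count (λ p → P? p ×-dec v ∈? p))          ≤⟨ sumOver-≤ (∁ B) degree ⟩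
    ∣ ∁ B ∣ * (N C r)                                              ≡⟨ cong (_* (N C r)) ∣∁B∣≡ ⟩
    suc (suc N) * (N C r)                                          ∎
    where
    pointwise : ∀ p → R * 𝟙 (P? p) ≤ sumOver (∁ B) (λ v → 𝟙 (P? p ×-dec v ∈? p))
    pointwise p with P? p
    ... | no  _  = ≤-trans (≤-reflexive (*-zeroʳ R)) z≤n
    ... | yes Pp = ≤-trans
      (≤-reflexive (trans (*-identityʳ R) (sym (∣∁p∩q∣≡r (proj₁ (shape Pp)) (proj₂ (shape Pp))))))
      (∣∩∣≤sumOver (∁ B) p)

-- Greedy packings

∣p∪q∣+∣p∩q∣≡∣p∣+∣q∣ : ∀ {n} (p q : Subset n) → ∣ p ∪ q ∣ + ∣ p ∩ q ∣ ≡ ∣ p ∣ + ∣ q ∣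
∣p∪q∣+∣p∩q∣≡∣p∣+∣q∣ []            []            = refl
∣p∪q∣+∣p∩q∣≡∣p∣+∣q∣ (inside  ∷ p) (inside  ∷ q) = cong suc (begin
  ∣ p ∪ q ∣ + suc ∣ p ∩ q ∣    ≡⟨ +-suc ∣ p ∪ q ∣ _ ⟩
  suc (∣ p ∪ q ∣ + ∣ p ∩ q ∣)  ≡⟨ cong suc (∣p∪q∣+∣p∩q∣≡∣p∣+∣q∣ p q) ⟩
  suc (∣ p ∣ + ∣ q ∣)          ≡⟨ +-suc ∣ p ∣ _ ⟨
  ∣ p ∣ + suc ∣ q ∣            ∎)
  where open ≡-Reasoning
∣p∪q∣+∣p∩q∣≡∣p∣+∣q∣ (inside  ∷ p) (outside ∷ q) = cong suc (∣p∪q∣+∣p∩q∣≡∣p∣+∣q∣ p q)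
∣p∪q∣+∣p∩q∣≡∣p∣+∣q∣ (outside ∷ p) (inside  ∷ q) = trans (cong suc (∣p∪q∣+∣p∩q∣≡∣p∣+∣q∣ p q)) (sym (+-suc ∣ p ∣ _))
∣p∪q∣+∣p∩q∣≡∣p∣+∣q∣ (outside ∷ p) (outside ∷ q) = ∣p∪q∣+∣p∩q∣≡∣p∣+∣q∣ p q

∣p∪q∣≤∣p∣+∣q∣ : ∀ {n} (p q : Subset n) → ∣ p ∪ q ∣ ≤ ∣ p ∣ + ∣ q ∣
∣p∪q∣≤∣p∣+∣q∣ p q = ≤-trans (m≤m+n _ _) (≤-reflexive (∣p∪q∣+∣p∩q∣≡∣p∣+∣q∣ p q))

1+∣p-x∣≡∣p∣ : ∀ {n} {p : Subset n} {x} → x ∈ p → suc ∣ p - x ∣ ≡ ∣ p ∣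
1+∣p-x∣≡∣p∣ {p = _ ∷ p} here = cong (suc ∘ ∣_∣) (p─⊥≡p p)
1+∣p-x∣≡∣p∣ {p = inside  ∷ p} (there x∈p) = cong suc (1+∣p-x∣≡∣p∣ x∈p)
1+∣p-x∣≡∣p∣ {p = outside ∷ p} (there x∈p) = 1+∣p-x∣≡∣p∣ x∈p

x∈p-y⇒x≢y : ∀ {n} (p : Subset n) {x y} → x ∈ p - y → x ≢ y
x∈p-y⇒x≢y (_ ∷ p) {zero}  {zero}  ()
x∈p-y⇒x≢y (_ ∷ p) {zero}  {suc y} _ ()
x∈p-y⇒x≢y (_ ∷ p) {suc x} {zero}  _ ()
x∈p-y⇒x≢y (_ ∷ p) {suc x} {suc y} (there x∈) refl = x∈p-y⇒x≢y p x∈ refl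

∃-subset-of-size : ∀ {n} (p : Subset n) {u} → u ≤ ∣ p ∣ → ∃ λ q → q ⊆ p × ∣ q ∣ ≡ u
∃-subset-of-size {n} p {zero} _ = ⊥ , (λ x∈⊥ → contradiction x∈⊥ ∉⊥) , ∣⊥∣≡0 n
∃-subset-of-size (inside ∷ p) {suc u} (s≤s u≤) =
  let q , q⊆p , eq = ∃-subset-of-size p u≤ in inside ∷ q , in⊆in q⊆p , cong suc eq
∃-subset-of-size (outside ∷ p) {suc u} u≤ =
  let q , q⊆p , eq = ∃-subset-of-size p u≤ in outside ∷ q , out⊆ q⊆p , eq

∣p∣>0⇒Nonempty : ∀ {n} (p : Subset n) → 0 < ∣ p ∣ → Nonempty p
∣p∣>0⇒Nonempty (inside  ∷ p) _   = zero , here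
∣p∣>0⇒Nonempty (outside ∷ p) 0<p = let x , x∈p = ∣p∣>0⇒Nonempty p 0<p in suc x , there x∈p

-- Disjointness, written as inclusion in a complement

⊆∁-or-meets : ∀ {n} (p q : Subset n) → p ⊆ ∁ q ⊎ ∃ λ v → v ∈ q × v ∈ p
⊆∁-or-meets p q with any? (λ v → v ∈? q ×-dec v ∈? p)
... | yes meets = inj₂ meets
... | no  none  = inj₁ λ v∈p → x∉p⇒x∈∁p λ v∈q → none (_ , v∈q , v∈p)

⊆∁-sym : ∀ {n} {p q : Subset n} → p ⊆ ∁ q → q ⊆ ∁ p
⊆∁-sym p⊆∁q x∈q = x∉p⇒x∈∁p λ x∈p → x∈p⇒x∉∁p x∈q (p⊆∁q x∈p)

⊆∁-∪ : ∀ {n} {p q r : Subset n} → p ⊆ ∁ q → p ⊆ ∁ r → p ⊆ ∁ (q ∪ r)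
⊆∁-∪ {q = q} {r} p⊆∁q p⊆∁r x∈p =
  x∉p⇒x∈∁p ([ x∈∁p⇒x∉p (p⊆∁q x∈p) , x∈∁p⇒x∉p (p⊆∁r x∈p) ]′ ∘ x∈p∪q⁻ q r)

⊆∁-antitone : ∀ {n} {p q r : Subset n} → q ⊆ r → p ⊆ ∁ r → p ⊆ ∁ q
⊆∁-antitone q⊆r p⊆∁r x∈p = x∉p⇒x∈∁p λ x∈q → x∈∁p⇒x∉p (p⊆∁r x∈p) (q⊆r x∈q)

∪-⊆ : ∀ {n} {p q r : Subset n} → p ⊆ r → q ⊆ r → p ∪ q ⊆ r
∪-⊆ {p = p} {q} p⊆r q⊆r = [ p⊆r , q⊆r ]′ ∘ x∈p∪q⁻ p q

-- Contrapositive of `count-avoiding`, with the pair found by finite search. The two sets are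
-- automatically distinct, since `i ≤ r` makes their intersection smaller than either of them.
∃-pair : ∀ {n i r} {P : Pred (Subset n) 0ℓ} (P? : Decidable P) B {N} →
  (∀ {p} → P p → B ⊆ p × ∣ p ∣ ≡ ∣ B ∣ + suc r) →
  i ≤ r → suc r ^ 3 ≤ N → ∣ ∁ B ∣ ≡ suc N → N C r < count P? →
  ∃₂ λ p q → P p × P q × ∣ p ∩ q ∣ ≡ ∣ B ∣ + i
∃-pair {i = i} P? B shape i≤r r³≤N ∣∁B∣≡ many
  with anySubset? (λ p → anySubset? (λ q → P? p ×-dec P? q ×-dec ∣ p ∩ q ∣ ≟ ∣ B ∣ + i))
... | yes pair    = pair
... | no  no-pair = contradiction many $ ≤⇒≯ $
  count-avoiding i P? B shape (λ Pp Pq eq → no-pair (_ , _ , Pp , Pq , eq)) i≤r r³≤N ∣∁B∣≡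

-- The index `W` is the set of vertices already forbidden. Each pair is added to it before the rest
-- is chosen, so disjointness is recorded step by step, in the order of the greedy choice.
data Packing {n : ℕ} (E : Pred (Subset n) 0ℓ) (b : ℕ) : ℕ → Subset n → Set where
  []   : ∀ {W} → Packing E b 0 W
  cons : ∀ {s W p q} → E p → E q → ∣ p ∩ q ∣ ≡ b → p ∪ q ⊆ ∁ W →
         Packing E b s (W ∪ (p ∪ q)) → Packing E b (suc s) W

-- k = κ + 2, b = β + 1 and n = N + 2.
module Greedy {κ β N m D : ℕ} {E : Pred (Subset (suc (suc N))) 0ℓ} (E? : Decidable E)
  (uniform : ∀ {p} → E p → ∣ p ∣ ≡ suc (suc κ)) (β≤κ : β ≤ κ)
  (m+b≡2k : m + suc β ≡ suc (suc κ) + suc (suc κ)) (k³<n : suc (suc κ) ^ 3 ≤ suc N) where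

  n : ℕ
  n = suc (suc N)

  degree : Fin n → ℕ
  degree v = count (λ p → E? p ×-dec v ∈? p)

  ∣p∪q∣≡m : ∀ {p q} → E p → E q → ∣ p ∩ q ∣ ≡ suc β → ∣ p ∪ q ∣ ≡ m
  ∣p∪q∣≡m {p} {q} Ep Eq ∣p∩q∣≡b = +-cancelʳ-≡ (suc β) _ _ (begin
    ∣ p ∪ q ∣ + suc β           ≡⟨ cong (∣ p ∪ q ∣ +_) ∣p∩q∣≡b ⟨
    ∣ p ∪ q ∣ + ∣ p ∩ q ∣       ≡⟨ ∣p∪q∣+∣p∩q∣≡∣p∣+∣q∣ p q ⟩
    ∣ p ∣ + ∣ q ∣               ≡⟨ cong₂ _+_ (uniform Ep) (uniform Eq) ⟩
    suc (suc κ) + suc (suc κ)   ≡⟨ m+b≡2k ⟨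
    m + suc β                   ∎)
    where open ≡-Reasoning

  ∣W∪[p∪q]∣≤ : ∀ {p q} W → E p → E q → ∣ p ∩ q ∣ ≡ suc β → ∣ W ∪ (p ∪ q) ∣ ≤ m + ∣ W ∣
  ∣W∪[p∪q]∣≤ {p} {q} W Ep Eq ∣p∩q∣≡b = ≤-trans (∣p∪q∣≤∣p∣+∣q∣ W (p ∪ q))
    (≤-reflexive (trans (+-comm ∣ W ∣ _) (cong (_+ ∣ W ∣) (∣p∪q∣≡m Ep Eq ∣p∩q∣≡b))))

  -- For each `w` in `W` at most `N C κ` edges contain both `v` and `w`. After discarding these,
  -- more than `N C κ` edges through `v` remain, and `∃-pair` applies with `v` as the common core.
  pair-through : ∀ v W → v ∉ W → suc ∣ W ∣ * (N C κ) < degree v →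
                 ∃₂ λ p q → E p × E q × ∣ p ∩ q ∣ ≡ suc β × p ∪ q ⊆ ∁ W
  pair-through v W v∉W high =
    let p , q , ((Ep , _) , p⊆∁W) , ((Eq , _) , q⊆∁W) , eq = pair in
    p , q , Ep , Eq , trans eq (cong (_+ β) (∣⁅x⁆∣≡1 v)) , ∪-⊆ p⊆∁W q⊆∁W
    where
    P? = λ p → (E? p ×-dec v ∈? p) ×-dec p ⊆? ∁ W
    ⁅v⁆⊆ : ∀ {p} → v ∈ p → ⁅ v ⁆ ⊆ p
    ⁅v⁆⊆ {p} v∈p x∈⁅v⁆ = subst (_∈ p) (sym (x∈⁅y⁆⇒x≡y v x∈⁅v⁆)) v∈p
    ∣∁⁅v⁆∣ : ∣ ∁ ⁅ v ⁆ ∣ ≡ suc N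
    ∣∁⁅v⁆∣ = trans (∣∁p∣≡n∸∣p∣ ⁅ v ⁆) (cong (n ∸_) (∣⁅x⁆∣≡1 v))
    codegree≤ : ∀ {w} → w ∈ W → count (λ p → (E? p ×-dec v ∈? p) ×-dec w ∈? p) ≤ N C κ
    codegree≤ {w} w∈W = count-⊇-≤ (λ p → (E? p ×-dec v ∈? p) ×-dec w ∈? p) (⁅ v ⁆ ∪ ⁅ w ⁆)
      (λ ((Ep , v∈p) , w∈p) → p∪⁅v⁆⊆q (⁅v⁆⊆ v∈p) w∈p ,
        trans (uniform Ep) (sym (trans (cong (_+ κ) (∣p∪⁅v⁆∣ w∉)) (cong (λ x → suc x + κ) (∣⁅x⁆∣≡1 v)))))
      (suc-injective (trans (sym (∣∁p∣≡1+∣∁[p∪⁅v⁆]∣ w∉)) ∣∁⁅v⁆∣))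
      where
      w∉ : w ∉ ⁅ v ⁆
      w∉ w∈⁅v⁆ = v∉W (subst (_∈ W) (x∈⁅y⁆⇒x≡y v w∈⁅v⁆) w∈W)
    degree≤ : degree v ≤ count P? + ∣ W ∣ * (N C κ)
    degree≤ = ≤-trans
      (count-split (λ p → E? p ×-dec v ∈? p) P?
        (λ p → (E? p ×-dec v ∈? p) ×-dec any? (λ w → w ∈? W ×-dec w ∈? p))
        (λ {p} Ep×v∈p → [ (λ p⊆∁W → inj₁ (Ep×v∈p , p⊆∁W)) , (λ meets → inj₂ (Ep×v∈p , meets)) ]′ (⊆∁-or-meets p W)))
      (+-monoʳ-≤ (count P?) (count-cover-≤
        (λ p → (E? p ×-dec v ∈? p) ×-dec any? (λ w → w ∈? W ×-dec w ∈? p))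
        (λ w p → (E? p ×-dec v ∈? p) ×-dec w ∈? p) W
        (λ (Ep×v∈p , w , w∈W , w∈p) → w , w∈W , Ep×v∈p , w∈p) codegree≤))
    pair = ∃-pair P? ⁅ v ⁆ {N}
      (λ ((Ep , v∈p) , _) → ⁅v⁆⊆ v∈p , trans (uniform Ep) (cong (_+ suc κ) (sym (∣⁅x⁆∣≡1 v))))
      β≤κ (s≤s⁻¹ (<-≤-trans (^-monoˡ-< 3 (n<1+n (suc κ))) k³<n)) ∣∁⁅v⁆∣
      (+-cancelʳ-< (∣ W ∣ * (N C κ)) _ _ (<-≤-trans high degree≤))

  -- Edges meeting `W` are bounded by degrees. The degrees in `T` may be large, so edges meeting `T`
  -- are bounded by the number of all `k`-sets that do. More than C(n-1, k-1) edges survive.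
  pair-avoiding : ∀ T W {Z} → count (λ p → ∣ p ∣ ≟ suc (suc κ) ×-dec ¬? (p ⊆? ∁ T)) ≤ Z →
                  (∀ {v} → v ∈ W → degree v ≤ D) → (suc N C suc κ) + ∣ W ∣ * D + Z < count E? →
                  ∃₂ λ p q → E p × E q × ∣ p ∩ q ∣ ≡ suc β × p ∪ q ⊆ ∁ (T ∪ W)
  pair-avoiding T W {Z} meetT≤Z low many =
    let p , q , ((Ep , p⊆∁T) , p⊆∁W) , ((Eq , q⊆∁T) , q⊆∁W) , eq = pair in
    p , q , Ep , Eq , trans eq (cong (_+ suc β) (∣⊥∣≡0 n)) ,
    ∪-⊆ (⊆∁-∪ p⊆∁T p⊆∁W) (⊆∁-∪ q⊆∁T q⊆∁W)
    where
    P?   = λ p → (E? p ×-dec p ⊆? ∁ T) ×-dec p ⊆? ∁ W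
    ET?  = λ p → E? p ×-dec p ⊆? ∁ T
    ETW? = λ p → E? p ×-dec any? (λ w → w ∈? W ×-dec w ∈? p)
    T?   = λ p → ∣ p ∣ ≟ suc (suc κ) ×-dec ¬? (p ⊆? ∁ T)
    open ≤-Reasoning
    ⊆∁T-or-not : ∀ {p} → E p → (E p × p ⊆ ∁ T) ⊎ (∣ p ∣ ≡ suc (suc κ) × ¬ (p ⊆ ∁ T))
    ⊆∁T-or-not {p} Ep with p ⊆? ∁ T
    ... | yes p⊆∁T = inj₁ (Ep , p⊆∁T)
    ... | no  p⊈∁T = inj₂ (uniform Ep , p⊈∁T)
    count≤ : count E? ≤ count P? + (∣ W ∣ * D + Z)
    count≤ = begin
      count E?                            ≤⟨ count-split E? ET? T? ⊆∁T-or-not ⟩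
      count ET? + count T?                ≤⟨ +-mono-≤ (count-split ET? P? ETW? λ {p} ET →
                                               [ (λ p⊆∁W → inj₁ (ET , p⊆∁W)) , (λ meets → inj₂ (proj₁ ET , meets)) ]′ (⊆∁-or-meets p W)) meetT≤Z ⟩
      count P? + count ETW? + Z           ≤⟨ +-monoˡ-≤ Z (+-monoʳ-≤ (count P?) (count-cover-≤ ETW? (λ w p → E? p ×-dec w ∈? p) W
                                               (λ (Ep , w , w∈W , w∈p) → w , w∈W , Ep , w∈p) low)) ⟩
      count P? + ∣ W ∣ * D + Z            ≡⟨ +-assoc (count P?) _ Z ⟩
      count P? + (∣ W ∣ * D + Z)          ∎
    pair = ∃-pair P? (⊥ {n}) {suc N}
      (λ ((Ep , _) , _) → (λ x∈⊥ → contradiction x∈⊥ ∉⊥) , trans (uniform Ep) (cong (_+ suc (suc κ)) (sym (∣⊥∣≡0 n))))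
      (s≤s β≤κ) k³<n (trans (∣∁p∣≡n∸∣p∣ (⊥ {n})) (cong (n ∸_) (∣⊥∣≡0 n)))
      (+-cancelʳ-< (∣ W ∣ * D + Z) _ _ (<-≤-trans (subst (_< count E?) (+-assoc (suc N C suc κ) _ Z) many) count≤))

  -- The copy through `v` also avoids the other vertices of `T`, which keeps them available for
  -- their own copies. `L` is a vertex budget: each of the `u` remaining rounds is allotted `m`
  -- vertices for its copy and one for its vertex of `T`.
  packing-through : ∀ u T W {L} → L * (N C κ) ≤ D → ∣ T ∣ ≡ u → T ⊆ ∁ W →
                    (∀ {v} → v ∈ T → D < degree v) → suc m * u + ∣ W ∣ ≤ L → Packing E (suc β) u W
  packing-through zero    T W L*≤D ∣T∣≡u T⊆∁W high size = []
  packing-through (suc u) T W {L} L*≤D ∣T∣≡u T⊆∁W high size =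
    let v , v∈T = ∣p∣>0⇒Nonempty T (≤-trans (s≤s z≤n) (≤-reflexive (sym ∣T∣≡u)))
        ∣T-v∣≡u = suc-injective (trans (1+∣p-x∣≡∣p∣ v∈T) ∣T∣≡u)
        p , q , Ep , Eq , eq , p∪q⊆ = pair-through v (W ∪ (T - v))
          ([ x∈∁p⇒x∉p (T⊆∁W v∈T) , (λ v∈T-v → x∈p-y⇒x≢y T v∈T-v refl) ]′ ∘ x∈p∪q⁻ W (T - v))
          (≤-<-trans (≤-trans (*-monoˡ-≤ (N C κ) (forbidden ∣T-v∣≡u)) L*≤D) (high v∈T))
    in cons Ep Eq eq (⊆∁-antitone (p⊆p∪q (T - v)) p∪q⊆) $
       packing-through u (T - v) (W ∪ (p ∪ q)) L*≤D ∣T-v∣≡u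
         (⊆∁-∪ (T⊆∁W ∘ p─q⊆p T ⁅ v ⁆) (⊆∁-sym (⊆∁-antitone (q⊆p∪q W (T - v)) p∪q⊆)))
         (high ∘ p─q⊆p T ⁅ v ⁆) (rest (∣W∪[p∪q]∣≤ W Ep Eq eq))
    where
    open ≤-Reasoning
    forbidden : ∀ {v} → ∣ T - v ∣ ≡ u → suc ∣ W ∪ (T - v) ∣ ≤ L
    forbidden {v} ∣T-v∣≡u = begin
      suc ∣ W ∪ (T - v) ∣       ≤⟨ s≤s (∣p∪q∣≤∣p∣+∣q∣ W (T - v)) ⟩
      suc (∣ W ∣ + ∣ T - v ∣)   ≡⟨ cong (λ x → suc (∣ W ∣ + x)) ∣T-v∣≡u ⟩
      suc (∣ W ∣ + u)           ≡⟨ cong suc (+-comm ∣ W ∣ u) ⟩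
      suc u + ∣ W ∣             ≤⟨ +-monoˡ-≤ ∣ W ∣ (m≤m+n (suc u) (m * suc u)) ⟩
      suc m * suc u + ∣ W ∣     ≤⟨ size ⟩
      L                         ∎
    rest : ∀ {x} → x ≤ m + ∣ W ∣ → suc m * u + x ≤ L
    rest {x} x≤ = begin
      suc m * u + x               ≤⟨ +-monoʳ-≤ (suc m * u) (m≤n⇒m≤1+n x≤) ⟩
      suc m * u + (suc m + ∣ W ∣) ≡⟨ +-assoc (suc m * u) _ _ ⟨
      suc m * u + suc m + ∣ W ∣   ≡⟨ cong (_+ ∣ W ∣) (trans (+-comm (suc m * u) _) (sym (*-suc (suc m) u))) ⟩
      suc m * suc u + ∣ W ∣       ≤⟨ size ⟩
      L                           ∎

  -- Of the `suc g` copies of the first phase, `j` are still to be chosen. They avoid `T`, so when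
  -- `j` reaches 0 the second phase can use all of `T`, and the vertices spent so far still fit into
  -- `L`.
  packing : ∀ j W {T u g L Z} → L * (N C κ) ≤ D → ∣ T ∣ ≡ u → T ⊆ ∁ W →
            (∀ {v} → v ∈ T → D < degree v) → (∀ {v} → v ∉ T → degree v ≤ D) →
            suc m * u + m * suc g ≤ L → m * j + ∣ W ∣ ≤ m * suc g →
            count (λ p → ∣ p ∣ ≟ suc (suc κ) ×-dec ¬? (p ⊆? ∁ T)) ≤ Z →
            (suc N C suc κ) + m * g * D + Z < count E? → Packing E (suc β) (j + u) W
  packing zero W {T} {u} L*≤D ∣T∣≡u T⊆∁W high low L≥ size meetT≤Z many =
    packing-through u T W L*≤D ∣T∣≡u T⊆∁W high (≤-trans (+-monoʳ-≤ (suc m * u) (m+n≤o⇒n≤o _ size)) L≥)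
  packing (suc j) W {T} {u} {g} {L} {Z} L*≤D ∣T∣≡u T⊆∁W high low L≥ size meetT≤Z many =
    extend (pair-avoiding T W meetT≤Z
      (λ v∈W → low (x∈∁p⇒x∉p (⊆∁-sym T⊆∁W v∈W)))
      (≤-<-trans (+-monoˡ-≤ Z (+-monoʳ-≤ (suc N C suc κ) (*-monoˡ-≤ D ∣W∣≤))) many))
    where
    open ≤-Reasoning
    -- At least one copy is still missing, so `W` holds at most `g` copies and not `suc g`; this is
    -- the factor `m * g` in the edge bound.
    ∣W∣≤ : ∣ W ∣ ≤ m * g
    ∣W∣≤ = +-cancelˡ-≤ m _ _ (begin
      m + ∣ W ∣           ≤⟨ +-monoˡ-≤ ∣ W ∣ (m≤m*n m (suc j)) ⟩
      m * suc j + ∣ W ∣   ≤⟨ size ⟩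
      m * suc g           ≡⟨ *-suc m g ⟩
      m + m * g           ∎)
    rest : ∀ {x} → x ≤ m + ∣ W ∣ → m * j + x ≤ m * suc g
    rest {x} x≤ = begin
      m * j + x               ≤⟨ +-monoʳ-≤ (m * j) x≤ ⟩
      m * j + (m + ∣ W ∣)     ≡⟨ +-assoc (m * j) _ _ ⟨
      m * j + m + ∣ W ∣       ≡⟨ cong (_+ ∣ W ∣) (trans (+-comm (m * j) _) (sym (*-suc m j))) ⟩
      m * suc j + ∣ W ∣       ≤⟨ size ⟩
      m * suc g               ∎
    extend : (∃₂ λ p q → E p × E q × ∣ p ∩ q ∣ ≡ suc β × p ∪ q ⊆ ∁ (T ∪ W)) →
             Packing E (suc β) (suc j + u) W
    extend (p , q , Ep , Eq , eq , p∪q⊆) =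
      cons Ep Eq eq (⊆∁-antitone (q⊆p∪q T W) p∪q⊆) $
      packing j (W ∪ (p ∪ q)) {T} {u} {g} {L} {Z} L*≤D ∣T∣≡u
        (⊆∁-∪ T⊆∁W (⊆∁-sym (⊆∁-antitone (p⊆p∪q W) p∪q⊆)))
        high low L≥ (rest (∣W∪[p∪q]∣≤ W Ep Eq eq)) meetT≤Z many

-- From packings to tilings

module _ {n : ℕ} {P : Pred (Fin n) 0ℓ} (P? : Decidable P) where

  ∈-tabulate⁺ : ∀ {v} → P v → v ∈ tabulate (does ∘ P?)
  ∈-tabulate⁺ {v} Pv = lookup⇒[]= v _ (trans (lookup∘tabulate (does ∘ P?) v) (dec-true (P? v) Pv))

  ∈-tabulate⁻ : ∀ {v} → v ∈ tabulate (does ∘ P?) → P v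
  ∈-tabulate⁻ {v} v∈ with P? v | trans (sym (lookup∘tabulate (does ∘ P?) v)) ([]=⇒lookup v∈)
  ... | yes Pv | _ = Pv
  ... | no  _  | ()

-- Listing the elements of a subset

elements : ∀ {n} → Subset n → List (Fin n)
elements []            = []
elements (inside  ∷ p) = zero ∷ List.map suc (elements p)
elements (outside ∷ p) = List.map suc (elements p)

length-elements : ∀ {n} (p : Subset n) → length (elements p) ≡ ∣ p ∣
length-elements []            = refl
length-elements (inside  ∷ p) = cong suc (trans (length-map suc (elements p)) (length-elements p))
length-elements (outside ∷ p) = trans (length-map suc (elements p)) (length-elements p)

∈-elements⁺ : ∀ {n} {p : Subset n} {v} → v ∈ p → v List.∈ elements p
∈-elements⁺ here = here refl
∈-elements⁺ {p = inside  ∷ p} (there v∈p) = there (∈-map⁺ suc (∈-elements⁺ v∈p))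
∈-elements⁺ {p = outside ∷ p} (there v∈p) = ∈-map⁺ suc (∈-elements⁺ v∈p)

∈-elements⁻ : ∀ {n} (p : Subset n) {v} → v List.∈ elements p → v ∈ p
∈-elements⁻ (inside ∷ p) (here refl) = here
∈-elements⁻ (inside ∷ p) (there v∈) with _ , w∈ , refl ← ∈-map⁻ suc v∈ = there (∈-elements⁻ p w∈)
∈-elements⁻ (outside ∷ p) v∈ with _ , w∈ , refl ← ∈-map⁻ suc v∈ = there (∈-elements⁻ p w∈)

elements-unique : ∀ {n} (p : Subset n) → Unique (elements p)
elements-unique []            = []
elements-unique (inside  ∷ p) =
  All.map⁺ (All.universal (λ _ ()) (elements p)) ∷ Unique.map⁺ Fin.suc-injective (elements-unique p)
elements-unique (outside ∷ p) = Unique.map⁺ Fin.suc-injective (elements-unique p)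

lookup-injective : ∀ {A : Set} {xs : List A} → Unique xs → Injective _≡_ _≡_ (List.lookup xs)
lookup-injective (x∉xs ∷ _)   {zero}  {zero}  _  = refl
lookup-injective (x∉xs ∷ _)   {zero}  {suc j} eq = contradiction eq (All.lookup x∉xs (∈-lookup j))
lookup-injective (x∉xs ∷ _)   {suc i} {zero}  eq = contradiction (sym eq) (All.lookup x∉xs (∈-lookup i))
lookup-injective (_ ∷ unique) {suc i} {suc j} eq = cong suc (lookup-injective unique eq)

module _ {A : Set} where

  lookup-prefix⁻ : ∀ (xs : List A) {ys} i → toℕ i < length xs → List.lookup (xs ++ ys) i List.∈ xs
  lookup-prefix⁻ (x ∷ xs) zero    _         = here refl
  lookup-prefix⁻ (x ∷ xs) (suc i) (s≤s i<l) = there (lookup-prefix⁻ xs i i<l)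

  lookup-prefix⁺ : ∀ {xs : List A} {ys v} → v List.∈ xs →
                   ∃ λ i → toℕ i < length xs × List.lookup (xs ++ ys) i ≡ v
  lookup-prefix⁺ (here refl) = zero , s≤s z≤n , refl
  lookup-prefix⁺ (there v∈xs) = let i , i<l , eq = lookup-prefix⁺ v∈xs in suc i , s≤s i<l , eq

  lookup-suffix⁻ : ∀ (xs : List A) {ys} i → ¬ (toℕ i < length xs) → List.lookup (xs ++ ys) i List.∈ ys
  lookup-suffix⁻ []       i       _   = ∈-lookup i
  lookup-suffix⁻ (x ∷ xs) zero    i≮l = contradiction (s≤s z≤n) i≮l
  lookup-suffix⁻ (x ∷ xs) (suc i) i≮l = lookup-suffix⁻ xs i (i≮l ∘ s≤s)

  lookup-suffix⁺ : ∀ (xs : List A) {ys v} → v List.∈ ys →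
                   ∃ λ i → ¬ (toℕ i < length xs) × List.lookup (xs ++ ys) i ≡ v
  lookup-suffix⁺ []       (here refl) = zero , (λ ()) , refl
  lookup-suffix⁺ []       (there v∈ys) =
    let i , _ , eq = lookup-suffix⁺ [] v∈ys in suc i , (λ ()) , eq
  lookup-suffix⁺ (x ∷ xs) v∈ys =
    let i , i≮l , eq = lookup-suffix⁺ xs v∈ys in suc i , (λ { (s≤s i<l) → i≮l i<l }) , eq

module _ {n : ℕ} where

  -- The length equation lets the domain be the vertex set of `Y`, whose size is not the length of
  -- the list by computation; facts about lists transfer by matching on `refl`.
  listEmbedding : (L : List (Fin n)) → ∀ {M} → length L ≡ M → Fin M → Fin n
  listEmbedding L refl = List.lookup L

  listEmbedding-injective : ∀ {L M} (len : length L ≡ M) → Unique L → Injective _≡_ _≡_ (listEmbedding L len)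
  listEmbedding-injective refl = lookup-injective

  listEmbedding-∈ : ∀ {L M} (len : length L ≡ M) u → listEmbedding L len u List.∈ L
  listEmbedding-∈ refl u = ∈-lookup u

  ∈-image⁺ : ∀ {m} (f : Fin m → Fin n) p {i v} → i ∈ p → f i ≡ v → v ∈ image f p
  ∈-image⁺ f p i∈p eq = ∈-tabulate⁺ (λ j → any? λ i → (i ∈? p) ×-dec (f i Fin.≟ j)) (_ , i∈p , eq)

  ∈-image⁻ : ∀ {m} (f : Fin m → Fin n) p {v} → v ∈ image f p → ∃ λ i → i ∈ p × f i ≡ v
  ∈-image⁻ f p = ∈-tabulate⁻ (λ j → any? λ i → (i ∈? p) ×-dec (f i Fin.≟ j))

  image-initial : ∀ p {L xs ys M j} (len : length L ≡ M) → L ≡ xs ++ ys → length xs ≡ j →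
                  (∀ {v} → v ∈ p → v List.∈ xs) → (∀ {v} → v List.∈ xs → v ∈ p) →
                  image (listEmbedding L len) (initial M j) ≡ p
  image-initial p {xs = xs} {ys} refl refl refl p⊆xs xs⊆p = ⊆-antisym
    (λ v∈image → let i , i∈ , eq = ∈-image⁻ (List.lookup (xs ++ ys)) (initial _ (length xs)) v∈image in
      -- `initial` tabulates `_<ᵇ_`, to which `does` of `_<?_` computes, so membership in it can be
      -- read as `toℕ i < length xs`.
      subst (_∈ p) eq (xs⊆p (lookup-prefix⁻ xs i (∈-tabulate⁻ (λ i → toℕ i <? length xs) i∈))))
    (λ v∈p → let i , i<l , eq = lookup-prefix⁺ (p⊆xs v∈p) in
      ∈-image⁺ (List.lookup (xs ++ ys)) (initial _ (length xs)) (∈-tabulate⁺ (λ i → toℕ i <? length xs) i<l) eq)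

  image-∁initial : ∀ p {L xs ys M j} (len : length L ≡ M) → L ≡ xs ++ ys → length xs ≡ j →
                   (∀ {v} → v ∈ p → v List.∈ ys) → (∀ {v} → v List.∈ ys → v ∈ p) →
                   image (listEmbedding L len) (∁ (initial M j)) ≡ p
  image-∁initial p {xs = xs} {ys} refl refl refl p⊆ys ys⊆p = ⊆-antisym
    (λ v∈image → let i , i∈ , eq = ∈-image⁻ (List.lookup (xs ++ ys)) (∁ (initial _ (length xs))) v∈image in
      subst (_∈ p) eq (ys⊆p (lookup-suffix⁻ xs i
        (x∈∁p⇒x∉p i∈ ∘ ∈-tabulate⁺ (λ i → toℕ i <? length xs)))))
    (λ v∈p → let i , i≮l , eq = lookup-suffix⁺ xs (p⊆ys v∈p) in
      ∈-image⁺ (List.lookup (xs ++ ys)) (∁ (initial _ (length xs)))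
        (x∉p⇒x∈∁p (i≮l ∘ ∈-tabulate⁻ (λ i → toℕ i <? length xs))) eq)

-- Two edges with the right intersection as a copy of `Y`

module PairEmbedding {n k b : ℕ} (p q : Subset n) (∣p∣≡k : ∣ p ∣ ≡ k)
  (∣q∣≡k : ∣ q ∣ ≡ k) (∣p∩q∣≡b : ∣ p ∩ q ∣ ≡ b) where

  onlyP both onlyQ : List (Fin n)
  onlyP = elements (∁ q ∩ p)
  both  = elements (p ∩ q)
  onlyQ = elements (∁ p ∩ q)

  length-both : length both ≡ b
  length-both = trans (length-elements (p ∩ q)) ∣p∩q∣≡b

  length≡k∸b : ∀ (r x : Subset n) → ∣ r ∣ ≡ k → b + ∣ x ∣ ≡ ∣ r ∣ → length (elements x) ≡ k ∸ b
  length≡k∸b r x ∣r∣≡k eq = trans (length-elements x)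
    (trans (sym (m+n∸m≡n b ∣ x ∣)) (cong (_∸ b) (trans eq ∣r∣≡k)))

  length-onlyP : length onlyP ≡ k ∸ b
  length-onlyP = length≡k∸b p (∁ q ∩ p) ∣p∣≡k
    (trans (cong (_+ ∣ ∁ q ∩ p ∣) (trans (sym ∣p∩q∣≡b) (cong ∣_∣ (∩-comm p q)))) (∣p∩q∣+∣∁p∩q∣≡∣q∣ q p))

  length-onlyQ : length onlyQ ≡ k ∸ b
  length-onlyQ = length≡k∸b q (∁ p ∩ q) ∣q∣≡k
    (trans (cong (_+ ∣ ∁ p ∩ q ∣) (sym ∣p∩q∣≡b)) (∣p∩q∣+∣∁p∩q∣≡∣q∣ p q))

  b≤k : b ≤ k
  b≤k = ≤-trans (≤-reflexive (sym ∣p∩q∣≡b)) (≤-trans (∣p∩q∣≤∣p∣ p q) (≤-reflexive ∣p∣≡k))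

  length-onlyP++both : length (onlyP ++ both) ≡ k
  length-onlyP++both = trans (length-++ onlyP) (trans (cong₂ _+_ length-onlyP length-both) (m∸n+n≡m b≤k))

  -- In this order the first `k` positions list `p`, and the positions from `k ∸ b` on list `q`, in
  -- agreement with `firstEdge` and `lastEdge`.
  L : List (Fin n)
  L = (onlyP ++ both) ++ onlyQ

  lengthL : length L ≡ 2 * k ∸ b
  lengthL = begin
    length L                            ≡⟨ length-++ (onlyP ++ both) ⟩
    length (onlyP ++ both) + length onlyQ ≡⟨ cong₂ _+_ length-onlyP++both length-onlyQ ⟩
    k + (k ∸ b)                         ≡⟨ +-∸-assoc k b≤k ⟨
    k + k ∸ b                           ≡⟨ cong (λ x → k + x ∸ b) (+-identityʳ k) ⟨
    2 * k ∸ b                           ∎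
    where open ≡-Reasoning

  onlyP-∈ : ∀ {v} → v List.∈ onlyP → v ∈ p × v ∉ q
  onlyP-∈ v∈onlyP = let v∈∁q , v∈p = x∈p∩q⁻ (∁ q) p (∈-elements⁻ (∁ q ∩ p) v∈onlyP) in v∈p , x∈∁p⇒x∉p v∈∁q

  both-∈ : ∀ {v} → v List.∈ both → v ∈ p × v ∈ q
  both-∈ = x∈p∩q⁻ p q ∘ ∈-elements⁻ (p ∩ q)

  onlyQ-∈ : ∀ {v} → v List.∈ onlyQ → v ∉ p × v ∈ q
  onlyQ-∈ v∈onlyQ = let v∈∁p , v∈q = x∈p∩q⁻ (∁ p) q (∈-elements⁻ (∁ p ∩ q) v∈onlyQ) in x∈∁p⇒x∉p v∈∁p , v∈q

  onlyP++both⊆p : ∀ {v} → v List.∈ onlyP ++ both → v ∈ p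
  onlyP++both⊆p = [ proj₁ ∘ onlyP-∈ , proj₁ ∘ both-∈ ]′ ∘ ∈-++⁻ onlyP

  both++onlyQ⊆q : ∀ {v} → v List.∈ both ++ onlyQ → v ∈ q
  both++onlyQ⊆q = [ proj₂ ∘ both-∈ , proj₂ ∘ onlyQ-∈ ]′ ∘ ∈-++⁻ both

  p⊆onlyP++both : ∀ {v} → v ∈ p → v List.∈ onlyP ++ both
  p⊆onlyP++both {v} v∈p with v ∈? q
  ... | yes v∈q = ∈-++⁺ʳ onlyP (∈-elements⁺ (x∈p∩q⁺ (v∈p , v∈q)))
  ... | no  v∉q = ∈-++⁺ˡ (∈-elements⁺ (x∈p∩q⁺ (x∉p⇒x∈∁p v∉q , v∈p)))

  q⊆both++onlyQ : ∀ {v} → v ∈ q → v List.∈ both ++ onlyQ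
  q⊆both++onlyQ {v} v∈q with v ∈? p
  ... | yes v∈p = ∈-++⁺ˡ (∈-elements⁺ (x∈p∩q⁺ (v∈p , v∈q)))
  ... | no  v∉p = ∈-++⁺ʳ both (∈-elements⁺ (x∈p∩q⁺ (x∉p⇒x∈∁p v∉p , v∈q)))

  L-unique : Unique L
  L-unique = Unique.++⁺
    (Unique.++⁺ (elements-unique (∁ q ∩ p)) (elements-unique (p ∩ q)) λ (v∈onlyP , v∈both) → proj₂ (onlyP-∈ v∈onlyP) (proj₂ (both-∈ v∈both)))
    (elements-unique (∁ p ∩ q)) λ (v∈onlyP++both , v∈onlyQ) → proj₁ (onlyQ-∈ v∈onlyQ) (onlyP++both⊆p v∈onlyP++both)

  pairEmbedding : Fin (2 * k ∸ b) → Fin n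
  pairEmbedding = listEmbedding L lengthL

  pairEmbedding-injective : Injective _≡_ _≡_ pairEmbedding
  pairEmbedding-injective = listEmbedding-injective lengthL L-unique

  pairEmbedding-∈ : ∀ u → pairEmbedding u ∈ p ∪ q
  pairEmbedding-∈ u = x∈p∪q⁺ ([ inj₁ ∘ onlyP++both⊆p , inj₂ ∘ proj₂ ∘ onlyQ-∈ ]′ (∈-++⁻ (onlyP ++ both) (listEmbedding-∈ lengthL u)))

  image-firstEdge : image pairEmbedding (firstEdge k b) ≡ p
  image-firstEdge = image-initial p {xs = onlyP ++ both} {ys = onlyQ} lengthL refl length-onlyP++both p⊆onlyP++both onlyP++both⊆p

  image-lastEdge : image pairEmbedding (lastEdge k b) ≡ q
  image-lastEdge = image-∁initial q {xs = onlyP} {ys = both ++ onlyQ} lengthL (++-assoc onlyP both onlyQ) length-onlyP q⊆both++onlyQ both++onlyQ⊆q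

module _ {k b n : ℕ} (b<k : b < k) (H : KGraph k n) where

  ∈edges⇒∣p∣≡k : ∀ {p} → p List.∈ edges H → ∣ p ∣ ≡ k
  ∈edges⇒∣p∣≡k = All.lookup (uniform H)

  pairCopy : ∀ {p q} → p List.∈ edges H → q List.∈ edges H → ∣ p ∩ q ∣ ≡ b → Copy (Y k b b<k) H
  pairCopy {p} {q} p∈H q∈H ∣p∩q∣≡b = record
    { embed     = pairEmbedding
    ; injective = pairEmbedding-injective
    ; edge      = λ where
        (here refl)         → subst (List._∈ edges H) (sym image-firstEdge) p∈H
        (there (here refl)) → subst (List._∈ edges H) (sym image-lastEdge) q∈H
    }
    where open PairEmbedding p q (∈edges⇒∣p∣≡k p∈H) (∈edges⇒∣p∣≡k q∈H) ∣p∩q∣≡b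

  -- Avoidance of `W` strengthens the induction: the later copies avoid the vertices of the first
  -- pair, which makes them disjoint from the first copy.
  AvoidingTiling : ℕ → Subset n → Set
  AvoidingTiling s W = Σ (Tiling (Y k b b<k) H s) λ t → ∀ i u → embed (Tiling.copy t i) u ∉ W

  Packing⇒Tiling : ∀ {s W} → Packing (List._∈ edges H) b s W → AvoidingTiling s W
  Packing⇒Tiling [] = record { copy = λ () ; disjoint = λ { {()} } } , λ ()
  Packing⇒Tiling {suc s} {W} (cons {p = p} {q} p∈H q∈H ∣p∩q∣≡b p∪q⊆∁W packing) =
    record { copy = copies ; disjoint = disjoint′ } , avoids′
    where
    rest = Packing⇒Tiling packing
    open PairEmbedding p q (∈edges⇒∣p∣≡k p∈H) (∈edges⇒∣p∣≡k q∈H) ∣p∩q∣≡b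
    copies : Fin (suc s) → Copy (Y k b b<k) H
    copies zero    = pairCopy p∈H q∈H ∣p∩q∣≡b
    copies (suc i) = Tiling.copy (proj₁ rest) i
    avoids′ : ∀ i u → embed (copies i) u ∉ W
    avoids′ zero    u = x∈∁p⇒x∉p (p∪q⊆∁W (pairEmbedding-∈ u))
    avoids′ (suc i) u = proj₂ rest i u ∘ p⊆p∪q (p ∪ q)
    first-disjoint : ∀ i u v → pairEmbedding u ≢ embed (Tiling.copy (proj₁ rest) i) v
    first-disjoint i u v eq = proj₂ rest i v (q⊆p∪q W (p ∪ q) (subst (_∈ p ∪ q) eq (pairEmbedding-∈ u)))
    disjoint′ : ∀ {i j} → i ≢ j → ∀ u v → embed (copies i) u ≢ embed (copies j) v
    disjoint′ {zero}  {zero}  i≢j u v = contradiction refl i≢j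
    disjoint′ {zero}  {suc j} i≢j u v = first-disjoint j u v
    disjoint′ {suc i} {zero}  i≢j u v = first-disjoint i v u ∘ sym
    disjoint′ {suc i} {suc j} i≢j u v = Tiling.disjoint (proj₁ rest) (i≢j ∘ cong suc) u v

-- Duplicate-free lists as counted families

_≟ˢ_ : ∀ {n} (p q : Subset n) → Dec (p ≡ q)
_≟ˢ_ = ≡-dec Bool._≟_

_∈ˡ?_ : ∀ {n} (p : Subset n) xs → Dec (p List.∈ xs)
_∈ˡ?_ = DecMembership._∈?_ _≟ˢ_

-- By uniqueness the head is not among the sets counted for the tail, so every entry contributes a
-- set of its own.
length≤count : ∀ {n} {xs : List (Subset n)} → Unique xs → length xs ≤ count (λ p → p ∈ˡ? xs)
length≤count []                          = z≤n
length≤count {xs = x ∷ xs} (x∉xs ∷ unique) = ≤-trans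
  (+-mono-≤ (≤-trans (𝟙-yes (x ≟ˢ x) refl) (≤sumSubsets (λ p → 𝟙 (p ≟ˢ x)) x)) (length≤count unique))
  (count-disjoint (λ p → p ≟ˢ x) (λ p → p ∈ˡ? xs) (λ p → p ∈ˡ? (x ∷ xs)) here there
    λ { refl p∈xs → All.lookup x∉xs p∈xs refl })

-- Estimates for binomial coefficients

nCr≤[1+n]Cr : ∀ n r → n C r ≤ suc n C r
nCr≤[1+n]Cr n zero    = ≤-reflexive (trans (nC0≡1 n) (sym (nC0≡1 (suc n))))
nCr≤[1+n]Cr n (suc r) = ≤-trans (m≤n+m _ (n C r)) (≤-reflexive (nCk+nC[k+1]≡[n+1]C[k+1] n r))

C-monoˡ-≤ : ∀ {m n} r → m ≤ n → m C r ≤ n C r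
C-monoˡ-≤ {n = zero}  r z≤n = ≤-refl
C-monoˡ-≤ {m} {suc n} r m≤1+n with m≤n⇒m<n∨m≡n m≤1+n
... | inj₁ (s≤s m≤n) = ≤-trans (C-monoˡ-≤ r m≤n) (nCr≤[1+n]Cr n r)
... | inj₂ refl      = ≤-refl

C>0 : ∀ {r n} → r ≤ n → 0 < n C r
C>0 {zero}  {n}     z≤n       = ≤-reflexive (sym (nC0≡1 n))
C>0 {suc r} {suc n} (s≤s r≤n) =
  ≤-trans (C>0 r≤n) (≤-trans (m≤m+n _ _) (≤-reflexive (nCk+nC[k+1]≡[n+1]C[k+1] n r)))

-- Pascal's rule telescoped over `x` steps: each step adds a coefficient whose upper index is at
-- most `M`.
C-upper : ∀ x {q M} r → x + q ≤ suc M → (x + q) C suc r ≤ q C suc r + x * (M C r)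
C-upper zero    {q}     r _        = m≤m+n (q C suc r) 0
C-upper (suc x) {q} {M} r (s≤s x+q≤M) = begin
  suc (x + q) C suc r                    ≡⟨ nCk+nC[k+1]≡[n+1]C[k+1] (x + q) r ⟨
  (x + q) C r + (x + q) C suc r          ≤⟨ +-mono-≤ (C-monoˡ-≤ r x+q≤M) (C-upper x r (m≤n⇒m≤1+n x+q≤M)) ⟩
  M C r + (q C suc r + x * (M C r))      ≡⟨ comm (M C r) (q C suc r) (x * (M C r)) ⟩
  q C suc r + suc x * (M C r)            ∎
  where
  open ≤-Reasoning
  comm : ∀ a b c → a + (b + c) ≡ b + (a + c)
  comm = solve-∀

-- The same telescoping, with each added coefficient bounded below by `a C r`.
C-lower : ∀ x a r → a C suc r + x * (a C r) ≤ (x + a) C suc r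
C-lower zero    a r = ≤-reflexive (+-identityʳ _)
C-lower (suc x) a r = begin
  a C suc r + (a C r + x * (a C r))      ≡⟨ comm (a C suc r) (a C r) (x * (a C r)) ⟩
  a C r + (a C suc r + x * (a C r))      ≤⟨ +-mono-≤ (C-monoˡ-≤ r (m≤n+m a x)) (C-lower x a r) ⟩
  (x + a) C r + (x + a) C suc r          ≡⟨ nCk+nC[k+1]≡[n+1]C[k+1] (x + a) r ⟩
  suc (x + a) C suc r                    ∎
  where
  open ≤-Reasoning
  comm : ∀ a b c → a + (b + c) ≡ b + (a + c)
  comm = solve-∀

m≤m*m : ∀ m → m ≤ m * m
m≤m*m zero    = z≤n
m≤m*m (suc m) = m≤m+n (suc m) (m * suc m)

-- From k ≤ 2(k-1) and k ≤ m the cube is at most 2(k-1)m². Hence the assumed lower bound on n covers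
-- the cubic one needed for families with a forbidden intersection size.
cube≤ : ∀ {κ m s} → suc (suc κ) ≤ m → 1 ≤ s → suc (suc κ) ^ 3 ≤ (2 * m ^ 2 + 1) * suc κ * s
cube≤ {κ} {m} {s} k≤m 1≤s = begin
  k ^ 3                          ≤⟨ *-monoˡ-≤ (k ^ 2) (s≤s (≤-trans (m≤n+m (suc κ) κ) (≤-reflexive (cong (κ +_) (sym (+-identityʳ (suc κ))))))) ⟩
  2 * suc κ * k ^ 2              ≤⟨ *-monoʳ-≤ (2 * suc κ) (^-monoˡ-≤ 2 k≤m) ⟩
  2 * suc κ * m ^ 2              ≡⟨ comm (suc κ) (m ^ 2) ⟩
  2 * m ^ 2 * suc κ              ≤⟨ *-monoˡ-≤ (suc κ) (m≤m+n (2 * m ^ 2) 1) ⟩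
  (2 * m ^ 2 + 1) * suc κ        ≡⟨ *-identityʳ _ ⟨
  (2 * m ^ 2 + 1) * suc κ * 1    ≤⟨ *-monoʳ-≤ ((2 * m ^ 2 + 1) * suc κ) 1≤s ⟩
  (2 * m ^ 2 + 1) * suc κ * s    ∎
  where
  open ≤-Reasoning
  k = suc (suc κ)
  comm : ∀ a b → 2 * a * b ≡ 2 * b * a
  comm = solve-∀

-- Here q = n - s with n = N + 2 and s = σ + 1.
degree-bound : ∀ {κ m σ q N} → (2 * m ^ 2 + 1) * suc κ * suc σ ≤ q → σ + q ≡ suc N →
               m * (suc m * suc σ * (N C κ)) ≤ q C suc κ
degree-bound {κ} {m} {σ} {q} {N} large σ+q≡ = +-cancelʳ-≤ (σ * c) _ _ (begin
  -- Passing from C(n-1, k-1) down to `q C suc κ` loses at most `σ * c`, so this amount is added on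
  -- the left first. The total coefficient (m² + m + 1)s is then at most (2m² + 1)s, the factor in
  -- the bound on n.
  m * (suc m * suc σ * c) + σ * c   ≤⟨ +-monoʳ-≤ (m * (suc m * suc σ * c)) (*-monoˡ-≤ c (n≤1+n σ)) ⟩
  m * (suc m * suc σ * c) + suc σ * c ≡⟨ comm₁ m (suc σ) c ⟩
  (m * m + m + 1) * (suc σ * c)     ≤⟨ *-monoˡ-≤ (suc σ * c) (+-monoˡ-≤ 1 (+-monoʳ-≤ (m * m) (m≤m*m m))) ⟩
  (m * m + m * m + 1) * (suc σ * c) ≡⟨ comm₂ m (suc σ) c ⟩
  X * suc σ * c                     ≤⟨ *-cancelˡ-≤ (suc κ) step ⟩
  suc N C suc κ                     ≡⟨ cong (_C suc κ) σ+q≡ ⟨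
  (σ + q) C suc κ                   ≤⟨ C-upper σ κ (≤-reflexive σ+q≡) ⟩
  q C suc κ + σ * c                 ∎)
  where
  open ≤-Reasoning
  c = N C κ
  X = 2 * m ^ 2 + 1
  comm₁ : ∀ m s c → m * (suc m * s * c) + s * c ≡ (m * m + m + 1) * (s * c)
  comm₁ = solve-∀
  comm₂ : ∀ m s c → (m * m + m * m + 1) * (s * c) ≡ (2 * (m * (m * 1)) + 1) * s * c
  comm₂ = solve-∀
  comm₃ : ∀ a x s c → a * (x * s * c) ≡ x * a * s * c
  comm₃ = solve-∀
  -- By absorption C(n-1, k-1) is (n-1)/(k-1) times `c`, and n - 1 is at least `q`.
  step : suc κ * (X * suc σ * c) ≤ suc κ * (suc N C suc κ)
  step = begin
    suc κ * (X * suc σ * c)   ≡⟨ comm₃ (suc κ) X (suc σ) c ⟩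
    X * suc κ * suc σ * c     ≤⟨ *-monoˡ-≤ c large ⟩
    q * c                     ≤⟨ *-monoˡ-≤ c (≤-trans (m≤n+m q σ) (≤-reflexive σ+q≡)) ⟩
    suc N * c                 ≡⟨ absorption N κ ⟨
    suc κ * (suc N C suc κ)   ∎

-- The packing theorem

-- Complementary count: the `k`-sets that miss `T` are those inside `∁ T`, and they are disjoint
-- from the sets counted here.
count-meeting : ∀ {n} k (T : Subset n) →
                count (λ p → ∣ p ∣ ≟ k ×-dec ¬? (p ⊆? ∁ T)) ≤ n C k ∸ (n ∸ ∣ T ∣) C k
count-meeting {n} k T = m+n≤o⇒m≤o∸n _ (begin
  count meet? + (n ∸ ∣ T ∣) C k          ≡⟨ cong (λ x → count meet? + x C k) (∣∁p∣≡n∸∣p∣ T) ⟨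
  count meet? + ∣ ∁ T ∣ C k              ≡⟨ cong (count meet? +_) (count-⊆ (∁ T) k) ⟨
  count meet? + count avoid?             ≤⟨ count-disjoint meet? avoid? (λ p → p ⊆? ⊤ {n} ×-dec ∣ p ∣ ≟ k)
                                              (λ (eq , _) → ⊆-max _ , eq) (λ (_ , eq) → ⊆-max _ , eq)
                                              (λ (_ , meets) (p⊆∁T , _) → meets p⊆∁T) ⟩
  count (λ p → p ⊆? ⊤ {n} ×-dec ∣ p ∣ ≟ k)   ≡⟨ count-⊆ (⊤ {n}) k ⟩
  ∣ ⊤ {n} ∣ C k                          ≡⟨ cong (_C k) (∣⊤∣≡n n) ⟩
  n C k                                  ∎)
  where
  open ≤-Reasoning
  meet?  = λ p → ∣ p ∣ ≟ k ×-dec ¬? (p ⊆? ∁ T)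
  avoid? = λ p → p ⊆? ∁ T ×-dec ∣ p ∣ ≟ k

-- The shifted parameters and the equation `m + b ≡ k + k` keep truncated subtraction out of most of
-- the arithmetic.
∃-packing : ∀ {κ β N m σ} {E : Pred (Subset (suc (suc N))) 0ℓ} (E? : Decidable E) →
  let k = suc (suc κ) ; b = suc β ; n = suc (suc N) ; s = suc σ in
  (∀ {p} → E p → ∣ p ∣ ≡ k) → β ≤ κ → m + b ≡ k + k → k ≤ m →
  (2 * m ^ 2 + 1) * suc κ * s + s ≤ n →
  (n C k ∸ (n ∸ s + 1) C k) + suc N C suc κ + (suc N C κ) * m * s ≤ count E? →
  Packing E b s ⊥
∃-packing {κ} {β} {N} {m} {σ} {E} E? uniform β≤κ m+b≡2k k≤m n≥ many = packed
  where
  open ≤-Reasoning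
  k n s q a c L D : ℕ
  k = suc (suc κ)
  n = suc (suc N)
  s = suc σ
  q = n ∸ s
  a = q + 1
  c = N C κ
  -- The budget covers `m` vertices for each of the `s` copies and one reserved vertex for each high
  -- vertex.
  L = suc m * s
  D = L * c

  large : (2 * m ^ 2 + 1) * suc κ * s ≤ q
  large = m+n≤o⇒m≤o∸n _ n≥

  s+q≡n : s + q ≡ n
  s+q≡n = m+[n∸m]≡n (m+n≤o⇒n≤o ((2 * m ^ 2 + 1) * suc κ * s) n≥)

  k³<n : k ^ 3 ≤ suc N
  k³<n = begin
    k ^ 3   ≤⟨ cube≤ k≤m (s≤s z≤n) ⟩
    _       ≤⟨ large ⟩
    q       ≤⟨ m≤n+m q σ ⟩
    σ + q   ≡⟨ suc-injective s+q≡n ⟩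
    suc N   ∎

  open Greedy {D = D} E? uniform β≤κ m+b≡2k k³<n using (degree; packing-through; packing)

  high? : Decidable (λ v → D < degree v)
  high? v = D <? degree v

  T : Subset n
  T = tabulate (does ∘ high?)

  T-high : ∀ {v} → v ∈ T → D < degree v
  T-high = ∈-tabulate⁻ high?

  ⊆∁⊥ : ∀ {p : Subset n} → p ⊆ ∁ ⊥
  ⊆∁⊥ _ = x∉p⇒x∈∁p ∉⊥

  -- Here n - |T| equals `g + a` with `a` = n - s + 1. By `C-lower`, C(n-|T|, k) exceeds C(a, k) by
  -- at least g C(a, k-1), and this gain pays for the `m * g * D` edges that the copies chosen
  -- earlier may meet.
  few-high : ∀ {g} → ∣ T ∣ + suc g ≡ s → (suc N C suc κ) + m * g * D + (n C k ∸ (n ∸ ∣ T ∣) C k) < count E?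
  few-high {g} eq = begin-strict
    A + m * g * D + Z                      ≡⟨ +-assoc A _ Z ⟩
    A + (m * g * D + Z)                    ≡⟨ +-comm A _ ⟩
    m * g * D + Z + A                      ≤⟨ +-monoˡ-≤ A (m+n≤o⇒m≤o∸n _ saved) ⟩
    -- The strict inequality comes from the last summand of the edge hypothesis, which is positive.
    (n C k ∸ a C k) + A                    <⟨ m<m+n _ positive ⟩
    (n C k ∸ a C k) + A + (suc N C κ) * m * s ≤⟨ many ⟩
    count E?                               ∎
    where
    A Z : ℕ
    A = suc N C suc κ
    Z = n C k ∸ (n ∸ ∣ T ∣) C k
    n∸T≡g+a : n ∸ ∣ T ∣ ≡ g + a
    n∸T≡g+a = begin-equality
      n ∸ ∣ T ∣                             ≡⟨ cong (_∸ ∣ T ∣) (trans (sym s+q≡n) (cong (_+ q) (sym eq))) ⟩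
      ∣ T ∣ + suc g + q ∸ ∣ T ∣             ≡⟨ cong (_∸ ∣ T ∣) (+-assoc ∣ T ∣ (suc g) q) ⟩
      ∣ T ∣ + (suc g + q) ∸ ∣ T ∣           ≡⟨ m+n∸m≡n ∣ T ∣ (suc g + q) ⟩
      suc g + q                             ≡⟨ cong suc (+-comm g q) ⟩
      1 + (q + g)                           ≡⟨ comm q g ⟩
      g + a                                 ∎
      where
      comm : ∀ q g → 1 + (q + g) ≡ g + (q + 1)
      comm = solve-∀
    gain : m * g * D ≤ g * (a C suc κ)
    gain = begin
      m * g * D          ≡⟨ cong (_* D) (*-comm m g) ⟩
      g * m * D          ≡⟨ *-assoc g m D ⟩
      g * (m * D)        ≤⟨ *-monoʳ-≤ g (≤-trans (degree-bound {κ} {m} {σ} large (suc-injective s+q≡n)) (C-monoˡ-≤ (suc κ) (m≤m+n q 1))) ⟩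
      g * (a C suc κ)    ∎
    saved : m * g * D + Z + a C k ≤ n C k
    saved = begin
      m * g * D + Z + a C k                 ≤⟨ +-monoˡ-≤ (a C k) (+-monoˡ-≤ Z gain) ⟩
      g * (a C suc κ) + Z + a C k           ≡⟨ comm (g * (a C suc κ)) Z (a C k) ⟩
      Z + (a C k + g * (a C suc κ))         ≤⟨ +-monoʳ-≤ Z (C-lower g a (suc κ)) ⟩
      Z + (g + a) C k                       ≡⟨ cong (λ x → Z + x C k) n∸T≡g+a ⟨
      Z + (n ∸ ∣ T ∣) C k                   ≡⟨ m∸n+n≡m (C-monoˡ-≤ k (m∸n≤m n ∣ T ∣)) ⟩
      n C k                                 ∎
      where
      comm : ∀ x y z → x + y + z ≡ y + (z + x)
      comm = solve-∀
    positive : 0 < (suc N C κ) * m * s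
    positive = *-mono-≤ (*-mono-≤ (C>0 κ≤1+N) (≤-trans (s≤s z≤n) k≤m)) (s≤s (z≤n {σ}))
      where
      κ≤1+N : κ ≤ suc N
      κ≤1+N = begin
        κ         ≤⟨ m≤n+m κ 2 ⟩
        k         ≡⟨ *-identityʳ k ⟨
        k * 1     ≤⟨ *-monoʳ-≤ k (m^n>0 k 2) ⟩
        k ^ 3     ≤⟨ k³<n ⟩
        suc N     ∎

  packed : Packing E (suc β) s ⊥
  packed with ≤-total s ∣ T ∣
  ... | inj₁ s≤∣T∣ =
    let T′ , T′⊆T , ∣T′∣≡s = ∃-subset-of-size T s≤∣T∣ in
    packing-through s T′ ⊥ {L} ≤-refl ∣T′∣≡s ⊆∁⊥ (T-high ∘ T′⊆T)
      (≤-reflexive (trans (cong (L +_) (∣⊥∣≡0 n)) (+-identityʳ L)))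
  ... | inj₂ ∣T∣≤s with m≤n⇒∃[o]m+o≡n ∣T∣≤s
  -- Exactly `s` high vertices: `T` itself is used, and there is no first phase.
  ...   | zero  , eq = packing-through s T ⊥ {L} ≤-refl (trans (sym (+-identityʳ _)) eq) ⊆∁⊥ T-high
      (≤-reflexive (trans (cong (L +_) (∣⊥∣≡0 n)) (+-identityʳ L)))
  -- The first phase supplies the missing `suc g` copies, and both phases together stay within `L`.
  ...   | suc g , eq = subst (λ j → Packing E (suc β) j ⊥) (trans (+-comm (suc g) ∣ T ∣) eq)
    (packing (suc g) ⊥ {T} {L = L} ≤-refl refl ⊆∁⊥ T-high
      (λ v∉T → ≮⇒≥ (v∉T ∘ ∈-tabulate⁺ high?))
      (begin
        suc m * ∣ T ∣ + m * suc g       ≤⟨ +-monoʳ-≤ (suc m * ∣ T ∣) (*-monoˡ-≤ (suc g) (n≤1+n m)) ⟩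
        suc m * ∣ T ∣ + suc m * suc g   ≡⟨ *-distribˡ-+ (suc m) ∣ T ∣ (suc g) ⟨
        suc m * (∣ T ∣ + suc g)         ≡⟨ cong (suc m *_) eq ⟩
        L                               ∎)
      (≤-reflexive (trans (cong (m * suc g +_) (∣⊥∣≡0 n)) (+-identityʳ _)))
      (count-meeting k T) (few-high eq))

theorem1p3 : ∀ (k b : ℕ) → k ≥ 3 → 1 ≤ b → (b<k : b < k) →
    ∃ λ (s₀ : ℕ) → s₀ > 0 ×
    (∀ (s : ℕ) → s ≥ s₀ →
    ∀ (n : ℕ) → n ≥ (2 * (2 * k ∸ b) ^ 2 + 1) * (k ∸ 1) * s + s →
    ∀ (H : KGraph k n) →
    e H ≥ ((n C k) ∸ ((n ∸ s + 1) C k)) + ((n ∸ 1) C (k ∸ 1))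
    + ((n ∸ 1) C (k ∸ 2)) * (2 * k ∸ b) * s →
    Tiling (Y k b b<k) H s)
theorem1p3 (suc zero) b (s≤s ())
-- The value 1 suffices for `s₀`: the estimates hold for every `s` of the form `suc σ`.
theorem1p3 k@(suc (suc κ)) b@(suc β) _ _ b<k@(s≤s (s≤s β≤κ)) = 1 , s≤s z≤n , tiling
  where
  m : ℕ
  m = 2 * k ∸ b

  m+b≡k+k : m + b ≡ k + k
  m+b≡k+k = trans (m∸n+n≡m (≤-trans (<⇒≤ b<k) (m≤m+n k (k + 0)))) (cong (k +_) (+-identityʳ k))

  k≤m : k ≤ m
  k≤m = +-cancelʳ-≤ b k m (≤-trans (+-monoʳ-≤ k (<⇒≤ b<k)) (≤-reflexive (sym m+b≡k+k)))

  tiling : ∀ s → s ≥ 1 → ∀ n → n ≥ (2 * m ^ 2 + 1) * suc κ * s + s → (H : KGraph k n) →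
           e H ≥ ((n C k) ∸ ((n ∸ s + 1) C k)) + ((n ∸ 1) C suc κ) + ((n ∸ 1) C κ) * m * s →
           Tiling (Y k b b<k) H s
  -- The bound on `n` is a positive term plus `s ≥ 1`, so `n` is at least 2 and can be written as
  -- `suc (suc N)`.
  tiling s 1≤s zero n≥ H many = contradiction (m+n≤o⇒n≤o _ n≥) (<⇒≱ 1≤s)
  tiling s 1≤s (suc zero) n≥ H many =
    contradiction (≤-trans (+-mono-≤ (≤-trans (m^n>0 k 3) (cube≤ k≤m 1≤s)) 1≤s) n≥) (<⇒≱ ≤-refl)
  tiling (suc σ) 1≤s (suc (suc N)) n≥ H many =
    proj₁ (Packing⇒Tiling b<k H (∃-packing (_∈ˡ? edges H) (All.lookup (uniform H))
      β≤κ m+b≡k+k k≤m n≥ (≤-trans many (length≤count (unique H)))))
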